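{- For all integers $k\geq 1$ and $n\geq 2k+1$, the Kneser graph $K(n,k)$ has a cycle that visits at least a $\frac{2k}{n}$-fraction of all its vertices. In particular, for every $k\geq 1$, the odd graph $K(2k+1,k)$ has a cycle that visits at least a $\left(1-\frac{1}{2k+1}\right)$-fraction of all its vertices.
   Context: For integers $k\geq 1$ and $n\geq 2k+1$, the Kneser graph $K(n,k)$ is the graph whose vertices are all $k$-element subsets of $[n]=\{1,2,\ldots,n\}$, with an edge between two vertices whenever the two sets are disjoint. The odd graph is $K(2k+1,k)$. (For $k=1$, $K(n,1)$ is the complete graph on $n$ vertices, and a cycle visiting all its vertices counts as well.) -}

module Defs where

open import Data.Nat using (ℕ; _≤_; _*_)
open import Data.Nat.Combinatorics using (_C_)
open import Data.List using (List; []; _∷_; _++_; [_]; length)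
open import Data.List.Relation.Unary.All using (All)
open import Data.List.Relation.Unary.Linked using (Linked)
open import Data.List.Relation.Unary.Unique.Propositional using (Unique)
open import Data.Fin.Subset using (Subset; ∣_∣; _∩_; Empty)
open import Relation.Binary.PropositionalEquality using (_≡_)

IsVertex : (n k : ℕ) → Subset n → Set
IsVertex n k p = ∣ p ∣ ≡ k

Adjacent : {n : ℕ} → Subset n → Subset n → Set
Adjacent p q = Empty (p ∩ q)

record KneserCycle (n k : ℕ) : Set where
  field
    start    : Subset n
    rest     : List (Subset n)
    vertices : All (IsVertex n k) (start ∷ rest)
    distinct : Unique (start ∷ rest)
    long     : 3 ≤ length (start ∷ rest)
    edges    : Linked Adjacent (start ∷ rest ++ [ start ])

cycleLength : {n k : ℕ} → KneserCycle n k → ℕ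
cycleLength c = length (KneserCycle.start c ∷ KneserCycle.rest c)

numVertices : ℕ → ℕ → ℕ
numVertices n k = n C k

{-# OPTIONS --safe #-}
-- Fix the element n.  The k-sets containing n and the k-sets avoiding n span,
-- under disjointness, a bipartite graph on the (k-1)-sets and the k-sets of
-- [n-1], and a cycle through all (k-1)-sets visits 2·C(n-1,k-1) = (2k/n)·C(n,k)
-- vertices.  Cyclic bracket matching maps the k-sets U of [n-1] injectively to
-- k-sets disjoint from U, so it suffices to find, in the cover graph of the
-- levels k-1 and k of the (n-1)-cube, a cycle through the whole lower level.
--
-- These cycles are built by induction on the dimension m ≥ 2k-1: two cycles in
-- opposite facets are joined after permuting the coordinates of one of them.
-- The base case m = 2k-1 is the middle levels theorem, proved as in Mütze's
-- "book proof": rotating ordered trees yields a cycle factor indexed by plane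
-- trees, and the moves 110u0v ↔ 101u0v, each realised by a 6-cycle, connect all
-- trees.  If the moves are only applied at one fixed position of the word, the
-- 6-cycles do not interfere, and moves can be chosen greedily so that each one
-- joins a new cycle to the current one.
module Submission where

open import Defs
open import Data.Bool using (Bool; true; false; if_then_else_; not; _∧_; _∨_; _xor_)
import Data.Bool as Bool
import Data.Bool.Properties as Boolₚ
open import Data.Empty using (⊥; ⊥-elim)
open import Data.Fin using (zero; suc)
open import Data.Fin.Subset using (Subset; ∣_∣)
open import Data.List using (List; []; _∷_; _++_; _∷ʳ_; [_]; length; map; concatMap; initLast; _∷ʳ′_)
open import Data.List.Membership.Propositional using (_∈_; _∉_; find; lose)
open import Data.List.Membership.Propositional.Properties using (∈-∃++; ∈-++⁺ˡ; ∈-++⁺ʳ; ∈-++⁻; ∈-map⁺; ∈-map⁻; ∈-concatMap⁺; ∈-concatMap⁻)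
import Data.List.Membership.DecPropositional as DecMembership
open import Data.List.Properties using (length-++; length-map; map-++; map-∘; ++-assoc; ++-identityʳ; ∷-injective; ∷-injectiveʳ; ∷ʳ-injective; ∷ʳ-injectiveˡ)
open import Data.List.Relation.Binary.Permutation.Propositional as ↭ using (_↭_; refl; prep; swap; ↭-sym; ↭-trans; ↭-reflexive)
open import Data.List.Relation.Binary.Permutation.Propositional.Properties using (All-resp-↭; ∈-resp-↭; shift; ++-comm; ↭-length) renaming (map⁺ to ↭-map⁺)
open import Data.List.Relation.Binary.Pointwise as Pointwise using (Pointwise; []; _∷_)
open import Data.List.Relation.Binary.Subset.Propositional using (_⊆_)
open import Data.List.Relation.Unary.All as All using (All; []; _∷_; all?)
open import Data.List.Relation.Unary.All.Properties as Allₚ using (¬All⇒Any¬; ¬Any⇒All¬; All¬⇒¬Any)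
open import Data.List.Relation.Unary.AllPairs using ([]; _∷_; tail)
open import Data.List.Relation.Unary.Any using (here; there)
open import Data.List.Relation.Unary.Linked using (Linked; [-]; _∷_)
open import Data.List.Relation.Unary.Unique.Propositional using (Unique)
import Data.List.Relation.Unary.Unique.Propositional.Properties as Uniqueₚ
open import Data.Nat using (ℕ; zero; suc; _+_; _*_; _∸_; _≤_; _<_; z≤n; s≤s; ≤-pred)
open import Data.Nat.Combinatorics using (_C_; nCk+nC[k+1]≡[n+1]C[k+1]; nC1≡n)
open import Data.Nat.GeneralisedArithmetic using (iterate)
open import Data.Nat.Properties hiding (_≟_; ≤-pred)
open import Data.Nat.Tactic.RingSolver using (solve-∀)
open import Data.Product as Product using (_×_; ∃; ∃₂; Σ; _,_; proj₁; proj₂)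
open import Data.Sum using (_⊎_; inj₁; inj₂)
open import Data.Vec using (Vec; []; _∷_; here; there)
import Data.Vec.Properties as Vecₚ
open import Function using (_∘_; id)
open import Relation.Binary using (DecidableEquality)
open import Relation.Binary.PropositionalEquality using (_≡_; _≢_; refl; sym; trans; cong; cong₂; subst; subst₂; ≢-sym; module ≡-Reasoning)
open import Relation.Nullary using (yes; no; does; contradiction)
open import Relation.Nullary.Decidable using (dec-true; dec-false)

-- Joining two facets consumes an upper word that the cycle for the smaller levels avoids, so the
-- induction has to carry a `Missing` word along; each join frees a new one. A middle levels cycle
-- uses up both of its levels, hence has none to offer, and enters only as the partner `S₀`, which
-- contributes no spare word. With lower level k a spare exists from dimension 2k+2 on, which is
-- exactly what the Kneser graph on (k+1)-sets requires. In the middle levels, the trajectories of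
-- `ρ` are cut into one block `run N t` for each ordered tree t with n edges. A gluing rearranges
-- only the first three pairs of the blocks of t and `τ t`, so gluings at different pairs of trees
-- concern different blocks. On trees it composes `ρ` with the transposition of t and `τ t`; how the
-- cycles merge is then a question about permutations of a finite set alone.

private
  variable
    A : Set

-- Lists without repetition and the pigeonhole principle

Unique-resp-↭ : {xs ys : List A} → xs ↭ ys → Unique xs → Unique ys
Unique-resp-↭ refl         u                       = u
Unique-resp-↭ (prep x p)   (a ∷ u)                 = All-resp-↭ p a ∷ Unique-resp-↭ p u
Unique-resp-↭ (swap x y p) ((x≢y ∷ ax) ∷ (ay ∷ u)) =
  (≢-sym x≢y ∷ All-resp-↭ p ay) ∷ All-resp-↭ p ax ∷ Unique-resp-↭ p u
Unique-resp-↭ (↭.trans p q) u                      = Unique-resp-↭ q (Unique-resp-↭ p u)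

Unique⇒∉ : {x : A} {xs : List A} → Unique (x ∷ xs) → x ∉ xs
Unique⇒∉ (a ∷ _) = All¬⇒¬Any a

Unique-++⇒disjoint : (xs : List A) {ys : List A} → Unique (xs ++ ys) →
                     ∀ {x} → x ∈ xs → x ∈ ys → ⊥
Unique-++⇒disjoint (_ ∷ xs) (a ∷ _) (here refl) x∈ys = All¬⇒¬Any a (∈-++⁺ʳ xs x∈ys)
Unique-++⇒disjoint (_ ∷ xs) (_ ∷ u) (there x∈)  x∈ys = Unique-++⇒disjoint xs u x∈ x∈ys

⊆-remove : {x : A} {xs : List A} (as : List A) {bs : List A} → Unique (x ∷ xs) →
           x ∷ xs ⊆ as ++ x ∷ bs → xs ⊆ as ++ bs
⊆-remove {x = x} as u sub {v} v∈xs with ∈-++⁻ as (sub (there v∈xs))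
... | inj₁ v∈as          = ∈-++⁺ˡ v∈as
... | inj₂ (here refl)   = contradiction v∈xs (Unique⇒∉ u)
... | inj₂ (there v∈bs)  = ∈-++⁺ʳ as v∈bs

length-insert : (as : List A) {x : A} {bs : List A} → length (as ++ x ∷ bs) ≡ suc (length (as ++ bs))
length-insert as {x} {bs} = ↭-length (shift x as bs)

Unique-⊆⇒length≤ : {xs ys : List A} → Unique xs → xs ⊆ ys → length xs ≤ length ys
Unique-⊆⇒length≤ {xs = []}     u sub = z≤n
Unique-⊆⇒length≤ {xs = x ∷ xs} u@(_ ∷ u′) sub with ∈-∃++ (sub (here refl))
... | as , bs , refl = subst (suc (length xs) ≤_) (sym (length-insert as))
                         (s≤s (Unique-⊆⇒length≤ u′ (⊆-remove as u sub)))

-- Pigeonhole: if an element of `ys` occurred twice, `xs` would fit into a shorter list. This lets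
-- gluings be proved free of repetitions from an inclusion and a count, without comparing paths with
-- each other.
Unique-⊆⇒Unique : {xs ys : List A} → Unique xs → xs ⊆ ys → length ys ≤ length xs → Unique ys
Unique-⊆⇒Unique {xs = []}     {[]} u sub le = []
Unique-⊆⇒Unique {xs = x ∷ xs} u@(_ ∷ u′) sub le with ∈-∃++ (sub (here refl))
... | as , bs , refl = Unique-resp-↭ (↭-sym (shift x as bs)) (¬Any⇒All¬ _ x∉ ∷ u-rest)
  where
  le′ : length (as ++ bs) ≤ length xs
  le′ = ≤-pred (subst (_≤ suc (length xs)) (length-insert as) le)
  u-rest = Unique-⊆⇒Unique u′ (⊆-remove as u sub) le′
  x∉ : x ∉ as ++ bs
  x∉ x∈ = <-irrefl refl (≤-trans (Unique-⊆⇒length≤ u (λ where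
    (here refl) → x∈
    (there v∈)  → ⊆-remove as u sub v∈)) le′)

-- Walk R a xs b: consecutive elements of a ∷ xs ++ [ b ] are related by R,
-- so that Walk R a xs a says that a ∷ xs is a closed walk.
data Walk (R : A → A → Set) : A → List A → A → Set where
  last : ∀ {a b} → R a b → Walk R a [] b
  _∷_  : ∀ {a b c xs} → R a b → Walk R b xs c → Walk R a (b ∷ xs) c

infixr 5 _∷_

module _ {R : A → A → Set} where

  infixr 5 _++ʷ_

  _++ʷ_ : ∀ {a b c xs ys} → Walk R a xs b → Walk R b ys c → Walk R a (xs ++ b ∷ ys) c
  last r  ++ʷ w = r ∷ w
  (r ∷ v) ++ʷ w = r ∷ (v ++ʷ w)

  Walk-split : ∀ xs {a b c ys} → Walk R a (xs ++ b ∷ ys) c → Walk R a xs b × Walk R b ys c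
  Walk-split []       (r ∷ w) = last r , w
  Walk-split (x ∷ xs) (r ∷ w) with Walk-split xs w
  ... | v , v′ = (r ∷ v) , v′

  Walk-rotate : ∀ {a xs x} → Walk R a xs a → x ∈ a ∷ xs →
                ∃ λ ys → Walk R x ys x × (a ∷ xs ↭ x ∷ ys)
  Walk-rotate {xs = xs} w (here refl) = xs , w , refl
  Walk-rotate {a} {x = x} w (there x∈xs) with ∈-∃++ x∈xs
  ... | as , bs , refl with Walk-split as w
  ... | w₁ , w₂ = bs ++ a ∷ as , w₂ ++ʷ w₁ , ++-comm (a ∷ as) (x ∷ bs)

-- Orbits of an injective map

Step : (A → A) → A → A → Set
Step G x y = y ≡ G x

Walk-closed : ∀ {G : A → A} {a b xs} (cs : List A) → (∀ {x} → x ∈ cs → G x ∈ cs) →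
              Walk (Step G) a xs b → a ∈ cs → b ∈ cs
Walk-closed cs cl (last refl) a∈ = cl a∈
Walk-closed cs cl (refl ∷ w)  a∈ = Walk-closed cs cl w (cl a∈)

cycle-closed : ∀ {G : A → A} {a xs} → Walk (Step G) a xs a →
               ∀ {x} → x ∈ a ∷ xs → G x ∈ a ∷ xs
cycle-closed w x∈ with Walk-rotate w x∈
... | _ , last eq , p  = subst (_∈ _) eq (∈-resp-↭ (↭-sym p) (here refl))
... | _ , eq ∷ _ , p    = subst (_∈ _) eq (∈-resp-↭ (↭-sym p) (there (here refl)))

Walk-pred : ∀ {G : A → A} {a b xs} → Walk (Step G) a xs b → ∃ λ q → q ∈ a ∷ xs × b ≡ G q
Walk-pred (last eq) = _ , here refl , eq
Walk-pred (_ ∷ w) with Walk-pred w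
... | q , q∈ , eq = q , there q∈ , eq

reroute : ∀ {G G′ : A → A} {a a′ b xs} → Walk (Step G) a xs b → G′ a′ ≡ G a →
          (∀ {x} → x ∈ xs → G′ x ≡ G x) → Walk (Step G′) a′ xs b
reroute (last refl) eq eqs = last (sym eq)
reroute (refl ∷ w)  eq eqs = sym eq ∷ reroute w (eqs (here refl)) (eqs ∘ there)

module FiniteOrbits (P : A → Set) (bound : ℕ)
         (bounded : ∀ {xs} → Unique xs → All P xs → length xs ≤ bound)
         (_≟_ : DecidableEquality A) where

  module _ (G : A → A) (P-G : ∀ {x} → P x → P (G x))
           (G-injective : ∀ {x y} → P x → P y → G x ≡ G y → x ≡ y) where

    -- The walk is prolonged until it returns to `z`. Its end `e` cannot already occur in `xs`, for
    -- `e` would have two predecessors at different positions of the walk, while `G` is injective on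
    -- `P`. The bound on lists without repetition replaces an enumeration of `P`.
    orbit-from : ∀ fuel {z xs e} → Walk (Step G) z xs e → Unique (z ∷ xs) → All P (z ∷ xs) →
                 bound < length (z ∷ xs) + fuel →
                 ∃ λ ys → Walk (Step G) z ys z × Unique (z ∷ ys) × All P (z ∷ ys)
    orbit-from zero {z} {xs} w u ps lt =
      contradiction (bounded u ps) (<⇒≱ (subst (bound <_) (+-identityʳ _) lt))
    orbit-from (suc fuel) {z} {xs} {e} w u ps lt with e ≟ z
    ... | yes refl = xs , w , u , ps
    ... | no e≢z   = orbit-from fuel (w ++ʷ last refl) (Unique-resp-↭ p (¬Any⇒All¬ _ e∉ ∷ u))
                       (All-resp-↭ p (pe ∷ ps)) (subst (bound <_) lt-eq lt)
      where
      p : e ∷ z ∷ xs ↭ z ∷ xs ++ e ∷ []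
      p = ++-comm (e ∷ []) (z ∷ xs)
      pe : P e
      pe with Walk-pred w
      ... | q , q∈ , refl = P-G (All.lookup ps q∈)
      e∉xs : e ∉ xs
      e∉xs e∈ with ∈-∃++ e∈
      ... | as , bs , refl with Walk-split as w
      ... | w₁ , w₂ with Walk-pred w₁ | Walk-pred w₂
      ... | q₁ , q₁∈ , eq₁ | q₂ , q₂∈ , eq₂ =
        Unique-++⇒disjoint (z ∷ as) u q₁∈ (subst (_∈ e ∷ bs) (sym q₁≡q₂) q₂∈)
        where
        q₁≡q₂ : q₁ ≡ q₂
        q₁≡q₂ = G-injective (All.lookup ps (∈-++⁺ˡ q₁∈)) (All.lookup ps (∈-++⁺ʳ (z ∷ as) q₂∈))
                  (trans (sym eq₁) eq₂)
      e∉ : e ∉ z ∷ xs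
      e∉ (here e≡z)  = e≢z e≡z
      e∉ (there e∈)  = e∉xs e∈
      lt-eq : length (z ∷ xs) + suc fuel ≡ length (z ∷ xs ++ e ∷ []) + fuel
      lt-eq = trans (+-suc _ fuel) (cong (_+ fuel) (↭-length p))

    orbit : ∀ {z} → P z → ∃ λ ys → Walk (Step G) z ys z × Unique (z ∷ ys) × All P (z ∷ ys)
    orbit pz = orbit-from bound (last refl) ([] ∷ []) (pz ∷ []) (n<1+n bound)

-- Composing ρ with the transposition of x and τ x, where x lies on a given
-- cycle and τ x does not, joins to this cycle the orbit of τ x.  The choice of
-- transpositions is recorded by a τ-invariant predicate χ.
module Twisting (P : A → Set) (bound : ℕ)
         (bounded : ∀ {xs} → Unique xs → All P xs → length xs ≤ bound)
         (_≟_ : DecidableEquality A) (ρ τ : A → A)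
         (P-ρ : ∀ {x} → P x → P (ρ x)) (P-τ : ∀ {x} → P x → P (τ x))
         (ρ-injective : ∀ {x y} → P x → P y → ρ x ≡ ρ y → x ≡ y)
         (τ-involutive : ∀ x → τ (τ x) ≡ x) where

  open DecMembership _≟_ using (_∈?_)
  open FiniteOrbits P bound bounded _≟_

  twist : (A → Bool) → A → A
  twist χ x = if χ x then τ x else x

  Invariant : (A → Bool) → Set
  Invariant χ = ∀ x → χ (τ x) ≡ χ x

  twist-involutive : ∀ {χ} → Invariant χ → ∀ x → twist χ (twist χ x) ≡ x
  twist-involutive {χ} inv x with χ x in eq
  ... | true  rewrite inv x | eq = τ-involutive x
  ... | false rewrite eq = refl

  P-twist : ∀ χ {x} → P x → P (twist χ x)
  P-twist χ {x} px with χ x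
  ... | true  = P-τ px
  ... | false = px

  twist-injective : ∀ {χ} → Invariant χ → ∀ {x y} → twist χ x ≡ twist χ y → x ≡ y
  twist-injective {χ} inv {x} {y} eq =
    trans (sym (twist-involutive inv x)) (trans (cong (twist χ) eq) (twist-involutive inv y))

  toggle : A → (A → Bool) → A → Bool
  toggle x χ y = (does (y ≟ x) ∨ does (y ≟ τ x)) xor χ y

  does-τ : ∀ x y → does (τ y ≟ x) ≡ does (y ≟ τ x)
  does-τ x y with y ≟ τ x
  ... | yes refl = dec-true (_ ≟ _) (τ-involutive x)
  ... | no  y≢   = dec-false (_ ≟ _) (λ τy≡x → y≢ (trans (sym (τ-involutive y)) (cong τ τy≡x)))

  does-ττ : ∀ x y → does (τ y ≟ τ x) ≡ does (y ≟ x)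
  does-ττ x y = trans (does-τ (τ x) y) (cong (λ z → does (y ≟ z)) (τ-involutive x))

  toggle-invariant : ∀ x {χ} → Invariant χ → Invariant (toggle x χ)
  toggle-invariant x {χ} inv y
    rewrite does-τ x y | does-ττ x y | inv y | Boolₚ.∨-comm (does (y ≟ τ x)) (does (y ≟ x)) = refl

  twist-toggle : ∀ x {χ} → Invariant χ → twist (toggle x χ) x ≡ twist χ (τ x)
  twist-toggle x {χ} inv rewrite dec-true (x ≟ x) refl | inv x with χ x
  ... | true  = sym (τ-involutive x)
  ... | false = refl

  twist-toggle-τ : ∀ x {χ} → Invariant χ → twist (toggle x χ) (τ x) ≡ twist χ x
  twist-toggle-τ x {χ} inv
    rewrite toggle-invariant x inv x | dec-true (x ≟ x) refl with χ x
  ... | true  = refl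
  ... | false = τ-involutive x

  twist-toggle-other : ∀ x {χ y} → y ≢ x → y ≢ τ x → twist (toggle x χ) y ≡ twist χ y
  twist-toggle-other x {χ} {y} y≢x y≢τx
    rewrite dec-false (y ≟ x) y≢x | dec-false (y ≟ τ x) y≢τx = refl

  TwistedCycle : (A → Bool) → A → List A → Set
  TwistedCycle χ x xs = Walk (Step (ρ ∘ twist χ)) x xs x × Unique (x ∷ xs) × All P (x ∷ xs)

  -- Toggling exchanges the successors of `x` and `τ x`: from `x` the new walk follows the orbit of
  -- `τ x` up to `τ x` itself, and from there the old cycle behind `x`.
  extend : ∀ {χ x xs} → Invariant χ → TwistedCycle χ x xs → τ x ∉ x ∷ xs →
           ∃ λ ys → TwistedCycle (toggle x χ) x (ys ++ τ x ∷ xs)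
  extend {χ} {x} {xs} inv (w , u , ps) τx∉
    with orbit (ρ ∘ twist χ) (P-ρ ∘ P-twist χ)
           (λ px py → twist-injective inv ∘ ρ-injective (P-twist χ px) (P-twist χ py))
           (P-τ (All.lookup ps (here refl)))
  ... | ys , w′ , u′ , ps′ = ys , w-new ++ʷ w-old , Unique-resp-↭ p (Uniqueₚ.++⁺ u u′ disjoint)
                           , All-resp-↭ p (Allₚ.++⁺ ps ps′)
    where
    p : (x ∷ xs) ++ τ x ∷ ys ↭ x ∷ ys ++ τ x ∷ xs
    p = prep x (↭-trans (++-comm xs (τ x ∷ ys)) (↭-sym (shift (τ x) ys xs)))
    disjoint : ∀ {v} → v ∈ x ∷ xs × v ∈ τ x ∷ ys → ⊥
    disjoint (v∈ , here refl) = τx∉ v∈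
    disjoint (v∈ , there v∈ys) with ∈-∃++ v∈ys
    ... | as , bs , refl = τx∉ (Walk-closed (x ∷ xs) (cycle-closed w) (proj₂ (Walk-split as w′)) v∈)
    w-new : Walk (Step (ρ ∘ twist (toggle x χ))) x ys (τ x)
    w-new = reroute w′ (cong ρ (twist-toggle x inv)) λ {v} v∈ → cong ρ (twist-toggle-other x {χ}
      (λ { refl → disjoint (here refl , there v∈) })
      (λ { refl → Unique⇒∉ u′ v∈ }))
    w-old : Walk (Step (ρ ∘ twist (toggle x χ))) (τ x) xs x
    w-old = reroute w (cong ρ (twist-toggle-τ x inv)) λ {v} v∈ → cong ρ (twist-toggle-other x {χ}
      (λ { refl → Unique⇒∉ u v∈ })
      (λ { refl → τx∉ (there v∈) }))

  ClosedCycle : Set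
  ClosedCycle = ∃₂ λ χ x → ∃ λ xs → Invariant χ × TwistedCycle χ x xs ×
                (∀ {y} → y ∈ x ∷ xs → ρ y ∈ x ∷ xs) × (∀ {y} → y ∈ x ∷ xs → τ y ∈ x ∷ xs)

  grow : ∀ fuel {χ x xs} → Invariant χ → TwistedCycle χ x xs →
         bound < length (x ∷ xs) + fuel → ClosedCycle
  grow fuel {χ} {x} {xs} inv c@(w , u , ps) lt with all? (λ y → τ y ∈? (x ∷ xs)) (x ∷ xs)
  ... | yes closed = χ , x , xs , inv , c , ρ-closed , τ-closed
    where
    τ-closed : ∀ {y} → y ∈ x ∷ xs → τ y ∈ x ∷ xs
    τ-closed = All.lookup closed
    twist-closed : ∀ {y} → y ∈ x ∷ xs → twist χ y ∈ x ∷ xs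
    twist-closed {y} y∈ with χ y
    ... | true  = τ-closed y∈
    ... | false = y∈
    -- The element z = `twist χ y` is on the cycle, and its successor `ρ (twist χ z)` is `ρ y`.
    ρ-closed : ∀ {y} → y ∈ x ∷ xs → ρ y ∈ x ∷ xs
    ρ-closed {y} y∈ = subst (λ z → ρ z ∈ x ∷ xs) (twist-involutive inv y)
                        (cycle-closed w (twist-closed y∈))
  grow zero {χ} {x} {xs} inv c@(w , u , ps) lt | no _ =
    contradiction (bounded u ps) (<⇒≱ (subst (bound <_) (+-identityʳ _) lt))
  grow (suc fuel) {χ} {x} {xs} inv c@(w , u , ps) lt | no ¬closed
    with find (¬All⇒Any¬ (λ y → τ y ∈? (x ∷ xs)) (x ∷ xs) ¬closed)
  ... | y , y∈ , τy∉ with Walk-rotate w y∈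
  ... | ys , w′ , p
    with extend inv (w′ , Unique-resp-↭ p u , All-resp-↭ p ps) (τy∉ ∘ ∈-resp-↭ (↭-sym p))
  ... | zs , c′ = grow fuel (toggle-invariant y inv) c′ (≤-trans lt lt′)
    where
    open ≤-Reasoning
    lt′ : length (x ∷ xs) + suc fuel ≤ length (y ∷ zs ++ τ y ∷ ys) + fuel
    lt′ = begin
      length (x ∷ xs) + suc fuel            ≡⟨ +-suc _ fuel ⟩
      suc (length (x ∷ xs)) + fuel          ≡⟨ cong (λ l → suc l + fuel) (↭-length p) ⟩
      length (τ y ∷ y ∷ ys) + fuel          ≤⟨ +-monoˡ-≤ fuel (s≤s (s≤s (m≤n+m (length ys) (length zs)))) ⟩
      2 + (length zs + length ys) + fuel    ≡⟨ cong (λ l → suc l + fuel)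
                                                (sym (trans (length-insert zs) (cong suc (length-++ zs)))) ⟩
      length (y ∷ zs ++ τ y ∷ ys) + fuel    ∎

  closedCycle : ∀ {x} → P x → ClosedCycle
  closedCycle px with orbit ρ P-ρ ρ-injective px
  ... | xs , c = grow bound {χ = λ _ → false} (λ _ → refl) c (≤-trans (n<1+n bound) (s≤s (m≤n+m bound _)))

-- Words

Word : Set
Word = List Bool

ones zeros : Word → ℕ
ones []          = 0
ones (true ∷ w)  = suc (ones w)
ones (false ∷ w) = ones w
zeros []          = 0
zeros (true ∷ w)  = zeros w
zeros (false ∷ w) = suc (zeros w)

ones-++ : ∀ v w → ones (v ++ w) ≡ ones v + ones w
ones-++ []          w = refl
ones-++ (true ∷ v)  w = cong suc (ones-++ v w)
ones-++ (false ∷ v) w = ones-++ v w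

zeros-++ : ∀ v w → zeros (v ++ w) ≡ zeros v + zeros w
zeros-++ []          w = refl
zeros-++ (true ∷ v)  w = zeros-++ v w
zeros-++ (false ∷ v) w = cong suc (zeros-++ v w)

ones+zeros : ∀ w → ones w + zeros w ≡ length w
ones+zeros []          = refl
ones+zeros (true ∷ w)  = cong suc (ones+zeros w)
ones+zeros (false ∷ w) = trans (+-suc (ones w) (zeros w)) (cong suc (ones+zeros w))

choose : ℕ → ℕ → List Word
choose zero    zero    = [] ∷ []
choose zero    (suc k) = []
choose (suc m) zero    = map (false ∷_) (choose m zero)
choose (suc m) (suc k) = map (true ∷_) (choose m k) ++ map (false ∷_) (choose m (suc k))

∈-choose : ∀ w → w ∈ choose (length w) (ones w)
∈-choose []          = here refl
∈-choose (true ∷ w)  = ∈-++⁺ˡ (∈-map⁺ (true ∷_) (∈-choose w))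
∈-choose (false ∷ w) with ones w | ∈-choose w
... | zero  | w∈ = ∈-map⁺ (false ∷_) w∈
... | suc k | w∈ = ∈-++⁺ʳ (map (true ∷_) (choose (length w) k)) (∈-map⁺ (false ∷_) w∈)

choose-sound : ∀ m k {w} → w ∈ choose m k → length w ≡ m × ones w ≡ k
choose-sound zero zero (here refl) = refl , refl
choose-sound (suc m) zero w∈ with ∈-map⁻ (false ∷_) w∈
... | v , v∈ , refl with choose-sound m zero v∈
... | l , o = cong suc l , o
choose-sound (suc m) (suc k) w∈ with ∈-++⁻ (map (true ∷_) (choose m k)) w∈
... | inj₁ w∈₁ with ∈-map⁻ (true ∷_) w∈₁
...   | v , v∈ , refl with choose-sound m k v∈
...     | l , o = cong suc l , cong suc o
choose-sound (suc m) (suc k) w∈ | inj₂ w∈₂ with ∈-map⁻ (false ∷_) w∈₂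
...   | v , v∈ , refl with choose-sound m (suc k) v∈
...     | l , o = cong suc l , o

choose-unique : ∀ m k → Unique (choose m k)
choose-unique zero    zero    = [] ∷ []
choose-unique zero    (suc k) = []
choose-unique (suc m) zero    = Uniqueₚ.map⁺ ∷-injectiveʳ (choose-unique m zero)
choose-unique (suc m) (suc k) =
  Uniqueₚ.++⁺ (Uniqueₚ.map⁺ ∷-injectiveʳ (choose-unique m k))
              (Uniqueₚ.map⁺ ∷-injectiveʳ (choose-unique m (suc k))) disjoint
  where
  disjoint : ∀ {v} → v ∈ map (true ∷_) (choose m k) × v ∈ map (false ∷_) (choose m (suc k)) → ⊥
  disjoint (p , q) with ∈-map⁻ (true ∷_) p | ∈-map⁻ (false ∷_) q
  ... | _ , _ , refl | _ , _ , ()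

length-choose : ∀ m k → length (choose m k) ≡ m C k
length-choose zero    zero    = refl
length-choose zero    (suc k) = refl
length-choose (suc m) zero    = trans (length-map (false ∷_) (choose m zero)) (length-choose m zero)
length-choose (suc m) (suc k) = begin
  length (map (true ∷_) (choose m k) ++ map (false ∷_) (choose m (suc k)))
    ≡⟨ length-++ (map (true ∷_) (choose m k)) ⟩
  length (map (true ∷_) (choose m k)) + length (map (false ∷_) (choose m (suc k)))
    ≡⟨ cong₂ _+_ (trans (length-map _ (choose m k)) (length-choose m k))
                 (trans (length-map _ (choose m (suc k))) (length-choose m (suc k))) ⟩
  m C k + m C suc k
    ≡⟨ nCk+nC[k+1]≡[n+1]C[k+1] m k ⟩
  suc m C suc k ∎
  where open ≡-Reasoning

infix 4 _⋖_

data _⋖_ : Word → Word → Set where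
  here  : ∀ {w} → false ∷ w ⋖ true ∷ w
  there : ∀ {b v w} → v ⋖ w → b ∷ v ⋖ b ∷ w

⋖-++ʳ : ∀ {v w} u → v ⋖ w → v ++ u ⋖ w ++ u
⋖-++ʳ u here      = here
⋖-++ʳ u (there c) = there (⋖-++ʳ u c)

⋖-++ˡ : ∀ u {v w} → v ⋖ w → u ++ v ⋖ u ++ w
⋖-++ˡ []      c = c
⋖-++ˡ (b ∷ u) c = there (⋖-++ˡ u c)

rot : ℕ → Word → Word
rot zero    w       = w
rot (suc s) []      = []
rot (suc s) (b ∷ w) = rot s (w ∷ʳ b)

rot-⋖ : ∀ s {v w} → v ⋖ w → rot s v ⋖ rot s w
rot-⋖ zero    c         = c
rot-⋖ (suc s) (here {w}) = rot-⋖ s (⋖-++ˡ w here)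
rot-⋖ (suc s) (there c) = rot-⋖ s (⋖-++ʳ _ c)

length-∷ʳ : ∀ (w : Word) b → length (w ∷ʳ b) ≡ suc (length w)
length-∷ʳ []      b = refl
length-∷ʳ (_ ∷ w) b = cong suc (length-∷ʳ w b)

length-rot : ∀ s w → length (rot s w) ≡ length w
length-rot zero    w       = refl
length-rot (suc s) []      = refl
length-rot (suc s) (b ∷ w) = trans (length-rot s (w ∷ʳ b)) (length-∷ʳ w b)

ones-rot : ∀ s w → ones (rot s w) ≡ ones w
ones-rot zero    w       = refl
ones-rot (suc s) []      = refl
ones-rot (suc s) (b ∷ w) = trans (ones-rot s (w ∷ʳ b))
  (trans (ones-++ w [ b ]) (trans (+-comm (ones w) _) (sym (ones-++ [ b ] w))))

rot-++ : ∀ v w → rot (length v) (v ++ w) ≡ w ++ v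
rot-++ []      w = sym (++-identityʳ w)
rot-++ (b ∷ v) w = begin
  rot (length v) ((v ++ w) ∷ʳ b)   ≡⟨ cong (rot (length v)) (++-assoc v w [ b ]) ⟩
  rot (length v) (v ++ (w ∷ʳ b))   ≡⟨ rot-++ v (w ∷ʳ b) ⟩
  (w ∷ʳ b) ++ v                    ≡⟨ ++-assoc w [ b ] v ⟩
  w ++ b ∷ v                       ∎
  where open ≡-Reasoning

rot-length : ∀ w → rot (length w) w ≡ w
rot-length w = trans (cong (rot (length w)) (sym (++-identityʳ w))) (rot-++ w [])

rot-+ : ∀ d s w → rot (d + s) w ≡ rot s (rot d w)
rot-+ zero    s       w       = refl
rot-+ (suc d) zero    []      = refl
rot-+ (suc d) (suc s) []      = refl
rot-+ (suc d) s       (b ∷ w) = rot-+ d s (w ∷ʳ b)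

rot-injective : ∀ s {v w} → rot s v ≡ rot s w → v ≡ w
rot-injective zero    eq = eq
rot-injective (suc s) {[]}    {[]}    eq = refl
rot-injective (suc s) {[]}    {b ∷ w} eq =
  contradiction (trans (cong length eq) (length-rot (suc s) (b ∷ w))) λ ()
rot-injective (suc s) {a ∷ v} {[]}    eq =
  contradiction (trans (sym (length-rot (suc s) (a ∷ v))) (cong length eq)) λ ()
rot-injective (suc s) {a ∷ v} {b ∷ w} eq with ∷ʳ-injective v w (rot-injective s eq)
... | refl , refl = refl

-- Lattice paths that never go below zero

data Path : ℕ → Word → ℕ → Set where
  done : ∀ {h} → Path h [] h
  up   : ∀ {h e w} → Path (suc h) w e → Path h (true ∷ w) e
  down : ∀ {h e w} → Path h w e → Path (suc h) (false ∷ w) e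

_++ᵖ_ : ∀ {h i e v w} → Path h v i → Path i w e → Path h (v ++ w) e
done   ++ᵖ q = q
up p   ++ᵖ q = up (p ++ᵖ q)
down p ++ᵖ q = down (p ++ᵖ q)

Path-split : ∀ {h e} v {w} → Path h (v ++ w) e → ∃ λ i → Path h v i × Path i w e
Path-split []          p        = _ , done , p
Path-split (true ∷ v)  (up p)   with Path-split v p
... | i , q , r = i , up q , r
Path-split (false ∷ v) (down p) with Path-split v p
... | i , q , r = i , down q , r

Path-raise : ∀ {h w e} → Path h w e → Path (suc h) w (suc e)
Path-raise done     = done
Path-raise (up p)   = up (Path-raise p)
Path-raise (down p) = down (Path-raise p)

Path-height : ∀ {h w e} → Path h w e → h + ones w ≡ e + zeros w
Path-height done                    = refl
Path-height (up {h} {e} {w} p)      = trans (+-suc h (ones w)) (Path-height p)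
Path-height (down {h} {e} {w} p)    = trans (cong suc (Path-height p)) (sym (+-suc e (zeros w)))

-- The word changes the height by -d according to one path and by e according to the other.
Path-flat : ∀ {d w e} → Path d w 0 → Path 0 w e → d + e ≡ 0
Path-flat {d} {w} {e} p q = +-cancelʳ-≡ (zeros w) (d + e) 0 (begin
  d + e + zeros w     ≡⟨ +-assoc d e (zeros w) ⟩
  d + (e + zeros w)   ≡⟨ cong (d +_) (sym (Path-height q)) ⟩
  d + ones w          ≡⟨ Path-height p ⟩
  zeros w             ∎)
  where open ≡-Reasoning

-- Ordered trees, node u v standing for the Dyck word 1u0v

data Tree : Set where
  leaf : Tree
  node : Tree → Tree → Tree

node-injective : ∀ {t u t′ u′} → node t u ≡ node t′ u′ → t ≡ t′ × u ≡ u′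
node-injective refl = refl , refl

_≟_ : DecidableEquality Tree
leaf     ≟ leaf       = yes refl
leaf     ≟ node _ _   = no λ ()
node _ _ ≟ leaf       = no λ ()
node t u ≟ node t′ u′ with t ≟ t′ | u ≟ u′
... | yes refl | yes refl = yes refl
... | no t≢    | _        = no (t≢ ∘ proj₁ ∘ node-injective)
... | yes _    | no u≢    = no (u≢ ∘ proj₂ ∘ node-injective)

size : Tree → ℕ
size leaf       = 0
size (node t u) = suc (size t + size u)

str : Tree → Word
str leaf       = []
str (node t u) = true ∷ str t ++ false ∷ str u

infixr 5 _⊕_

_⊕_ : Tree → Tree → Tree
leaf     ⊕ w = w
node t u ⊕ w = node t (u ⊕ w)

⊕-identityʳ : ∀ t → t ⊕ leaf ≡ t
⊕-identityʳ leaf       = refl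
⊕-identityʳ (node t u) = cong (node t) (⊕-identityʳ u)

⊕-assoc : ∀ t u w → (t ⊕ u) ⊕ w ≡ t ⊕ (u ⊕ w)
⊕-assoc leaf       u w = refl
⊕-assoc (node t s) u w = cong (node t) (⊕-assoc s u w)

size-⊕ : ∀ t u → size (t ⊕ u) ≡ size t + size u
size-⊕ leaf       u = refl
size-⊕ (node t s) u = cong suc (trans (cong (size t +_) (size-⊕ s u)) (sym (+-assoc (size t) (size s) (size u))))

str-⊕ : ∀ t u → str (t ⊕ u) ≡ str t ++ str u
str-⊕ leaf       u = refl
str-⊕ (node t s) u = cong (true ∷_) (trans (cong (λ w → str t ++ false ∷ w) (str-⊕ s u))
                                           (sym (++-assoc (str t) (false ∷ str s) (str u))))

ones-str : ∀ t → ones (str t) ≡ size t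
ones-str leaf       = refl
ones-str (node t u) = cong suc (trans (ones-++ (str t) _) (cong₂ _+_ (ones-str t) (ones-str u)))

zeros-str : ∀ t → zeros (str t) ≡ size t
zeros-str leaf       = refl
zeros-str (node t u) = trans (zeros-++ (str t) _)
  (trans (+-suc _ _) (cong suc (cong₂ _+_ (zeros-str t) (zeros-str u))))

length-str : ∀ t → length (str t) ≡ size t + size t
length-str t = trans (sym (ones+zeros (str t))) (cong₂ _+_ (ones-str t) (zeros-str t))

str-cancel : ∀ t u {v w} → str t ++ false ∷ v ≡ str u ++ false ∷ w → t ≡ u × v ≡ w
str-cancel leaf leaf refl = refl , refl
str-cancel leaf (node _ _) ()
str-cancel (node _ _) leaf ()
str-cancel (node t t′) (node u u′) {v} {w} eq
  with str-cancel t u (trans (sym (++-assoc (str t) (false ∷ str t′) (false ∷ v)))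
         (trans (∷-injectiveʳ eq) (++-assoc (str u) (false ∷ str u′) (false ∷ w))))
... | refl , eq′ with str-cancel t′ u′ eq′
... | refl , eq″ = refl , eq″

str-injective : ∀ {t u} → str t ≡ str u → t ≡ u
str-injective {t} {u} eq = proj₁ (str-cancel t u {[]} {[]} (cong (_∷ʳ false) eq))

str-path : ∀ t {h} → Path h (str t) h
str-path leaf       = done
str-path (node t u) = up (str-path t ++ᵖ down (str-path u))

separated : ∀ {h} → Vec Tree h → Word
separated []       = []
separated (t ∷ ts) = false ∷ str t ++ separated ts

-- First-passage decomposition: the separating zeros are the steps that reach a new minimum.
parse : ∀ {h w} → Path h w 0 → ∃₂ λ t (ts : Vec Tree h) → w ≡ str t ++ separated ts
parse done = leaf , [] , refl
parse (up p) with parse p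
... | t , u ∷ us , refl =
  node t u , us , cong (true ∷_) (sym (++-assoc (str t) (false ∷ str u) (separated us)))
parse (down p) with parse p
... | t , ts , refl = leaf , t ∷ ts , refl

parse-Dyck : ∀ {w} → Path 0 w 0 → ∃ λ t → w ≡ str t
parse-Dyck p with parse p
... | t , [] , eq = t , trans eq (++-identityʳ (str t))

-- The cycle lemma

-- The word is cut after the first visit of its minimal height.
data Cut : Word → Set where
  nonneg : ∀ {w c} → Path 0 w c → Cut w
  cut    : ∀ p q {d c} → Path d p 0 → Path 0 q c → Cut (p ++ false ∷ q)

cutWord : ∀ w → Cut w
cutWord []          = nonneg done
cutWord (true ∷ w)  with cutWord w
... | nonneg p                 = nonneg (up (Path-raise p))
... | cut p q {zero} dp dq     = nonneg (up (Path-raise dp ++ᵖ down dq))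
... | cut p q {suc d} dp dq    = cut (true ∷ p) q (up dp) dq
cutWord (false ∷ w) with cutWord w
... | nonneg p                 = cut [] w done p
... | cut p q dp dq            = cut (false ∷ p) q (down dp) dq

-- For a cut p0q, the surplus of one zero forces the depth of p to equal the final height of q.
-- Hence qp is a Dyck word, and w is a rotation of qp0. The amount of rotation is taken between 1
-- and the length, to match the lower words of `run`.
cycle-lemma : ∀ w → zeros w ≡ suc (ones w) →
              ∃₂ λ t s → s < length w × w ≡ rot (suc s) (str t ∷ʳ false)
cycle-lemma w eq with cutWord w
... | nonneg {c = c} p = contradiction (trans (Path-height p) (cong (c +_) eq)) (<⇒≢ (m≤n+m _ c))
... | cut p q {d} {c} dp dq with parse-Dyck (dq ++ᵖ subst (λ h → Path h p 0) d≡c dp)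
  where
  open ≡-Reasoning
  d≡c : d ≡ c
  d≡c = +-cancelʳ-≡ (ones p + zeros q) d c (suc-injective (begin
    suc (d + (ones p + zeros q))   ≡⟨ cong suc (sym (+-assoc d (ones p) (zeros q))) ⟩
    suc (d + ones p + zeros q)     ≡⟨ cong (λ z → suc (z + zeros q)) (Path-height dp) ⟩
    suc (zeros p + zeros q)        ≡⟨ sym (+-suc (zeros p) (zeros q)) ⟩
    zeros p + suc (zeros q)        ≡⟨ sym (zeros-++ p (false ∷ q)) ⟩
    zeros (p ++ false ∷ q)         ≡⟨ eq ⟩
    suc (ones (p ++ false ∷ q))    ≡⟨ cong suc (ones-++ p (false ∷ q)) ⟩
    suc (ones p + ones q)          ≡⟨ cong (λ z → suc (ones p + z)) (Path-height dq) ⟩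
    suc (ones p + (c + zeros q))   ≡⟨ cong suc (exchange-summands (ones p) c (zeros q)) ⟩
    suc (c + (ones p + zeros q))   ∎))
    where
    exchange-summands : ∀ x y z → x + (y + z) ≡ y + (x + z)
    exchange-summands = solve-∀
-- Here w is already in the desired form; the rotation is a full turn instead of none.
cycle-lemma w eq | cut p [] dp dq | t , t≡ =
  t , length p , ≤-reflexive (sym (length-∷ʳ p false)) , (begin
    p ∷ʳ false                                 ≡⟨ sym (rot-length (p ∷ʳ false)) ⟩
    rot (length (p ∷ʳ false)) (p ∷ʳ false)     ≡⟨ cong₂ (λ l v → rot l (v ∷ʳ false)) (length-∷ʳ p false) t≡ ⟩
    rot (suc (length p)) (str t ∷ʳ false)      ∎)
  where open ≡-Reasoning
cycle-lemma w eq | cut p q@(b ∷ q′) dp dq | t , t≡ = t , length q′ , lt , sym (begin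
    rot (length q) (str t ∷ʳ false)     ≡⟨ cong (λ v → rot (length q) (v ∷ʳ false)) (sym t≡) ⟩
    rot (length q) ((q ++ p) ∷ʳ false)  ≡⟨ cong (rot (length q)) (++-assoc q p [ false ]) ⟩
    rot (length q) (q ++ (p ∷ʳ false))  ≡⟨ rot-++ q (p ∷ʳ false) ⟩
    (p ∷ʳ false) ++ q                   ≡⟨ ++-assoc p [ false ] q ⟩
    p ++ false ∷ q                      ∎)
  where
  open ≡-Reasoning
  lt : length q′ < length (p ++ false ∷ b ∷ q′)
  lt = subst (length q′ <_) (sym (length-++ p))
         (≤-trans (n≤1+n (suc (length q′))) (m≤n+m _ (length p)))

split-at : ∀ d (w : Word) → d ≤ length w → ∃₂ λ p q → w ≡ p ++ q × length p ≡ d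
split-at zero    w       le       = [] , w , refl , refl
split-at (suc d) (b ∷ w) (s≤s le) with split-at d w le
... | p , q , refl , refl = b ∷ p , q , refl , refl

-- Both words end in b, and without it they are the Dyck words qbp and pbq. In the first one p falls
-- to height 0 from wherever it starts, in the second one it rises from 0; the step b makes one of
-- the two changes nonzero, so they contradict each other.
no-proper-rotation : ∀ b t t′ p q c c′ → str t ∷ʳ b ≡ (q ∷ʳ c) ++ (p ∷ʳ c′) →
                     str t′ ∷ʳ b ≡ (p ∷ʳ c′) ++ (q ∷ʳ c) → ⊥
no-proper-rotation b t t′ p q c c′ eq eq′
  with ∷ʳ-injective (str t) ((q ∷ʳ c) ++ p) (trans eq (sym (++-assoc (q ∷ʳ c) p [ c′ ])))
     | ∷ʳ-injective (str t′) ((p ∷ʳ c′) ++ q) (trans eq′ (sym (++-assoc (p ∷ʳ c′) q [ c ])))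
... | t≡ , refl | t′≡ , refl
  with Path-split q (subst (λ w → Path 0 w 0) (trans t≡ (++-assoc q [ b ] p)) (str-path t))
     | Path-split p (subst (λ w → Path 0 w 0) (trans t′≡ (++-assoc p [ b ] q)) (str-path t′))
no-proper-rotation true  t t′ p q c c′ eq eq′ | _ , refl | _ , refl
  | i , _ , up dp | j , dp′ , _ = contradiction (Path-flat dp dp′) λ ()
no-proper-rotation false t t′ p q c c′ eq eq′ | _ , refl | _ , refl
  | suc i , _ , down dp | suc j , dp′ , down _ =
  contradiction (trans (sym (+-suc i j)) (Path-flat dp dp′)) λ ()

rot-aligned : ∀ b d i {t u} → d ≤ size u + size u →
              rot i (str t ∷ʳ b) ≡ rot (d + i) (str u ∷ʳ b) → d ≡ 0 × t ≡ u
rot-aligned b d i {t} {u} d≤ eq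
  with split-at d (str u ∷ʳ b) (≤-trans d≤ (≤-trans (n≤1+n _) (≤-reflexive (sym (length-str-∷ʳ)))))
     | rot-injective i (trans eq (rot-+ d i (str u ∷ʳ b)))
  where
  length-str-∷ʳ : length (str u ∷ʳ b) ≡ suc (size u + size u)
  length-str-∷ʳ = trans (length-∷ʳ (str u) b) (cong suc (length-str u))
... | p , q , u≡ , refl | eq′ with initLast p | initLast q
...   | []       | _        = refl , str-injective (∷ʳ-injectiveˡ (str t) (str u) eq′)
...   | p ∷ʳ′ c′ | []       = contradiction d≤ (<⇒≱ (≤-reflexive (begin
          suc (size u + size u)          ≡⟨ cong suc (sym (length-str u)) ⟩
          suc (length (str u))           ≡⟨ sym (length-∷ʳ (str u) b) ⟩
          length (str u ∷ʳ b)            ≡⟨ cong length u≡ ⟩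
          length ((p ∷ʳ c′) ++ [])       ≡⟨ cong length (++-identityʳ (p ∷ʳ c′)) ⟩
          length (p ∷ʳ c′)               ∎)))
  where open ≡-Reasoning
...   | p ∷ʳ′ c′ | q ∷ʳ′ c  = ⊥-elim (no-proper-rotation b t u p q c c′
          (trans eq′ (trans (cong (rot (length (p ∷ʳ c′))) u≡) (rot-++ (p ∷ʳ c′) (q ∷ʳ c)))) u≡)

-- The words have length 2n+1, and the bounds say that i and j are less than a full turn apart.
rot-∷ʳ-injective : ∀ b {i j n t u} → size t ≡ n → size u ≡ n → i ≤ j + (n + n) → j ≤ i + (n + n) →
                   rot i (str t ∷ʳ b) ≡ rot j (str u ∷ʳ b) → i ≡ j × t ≡ u
rot-∷ʳ-injective b {i} {j} {t = t} {u} refl u≈ i≤ j≤ eq with ≤-total i j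
... | inj₁ i≤j with j ∸ i | m∸n+n≡m i≤j
...   | d | refl with rot-aligned b d i {t} {u} (subst (λ n → d ≤ n + n) (sym u≈) (+-cancelʳ-≤ i _ _ (≤-trans j≤ (≤-reflexive (+-comm i _))))) eq
...     | refl , t≡u = refl , t≡u
rot-∷ʳ-injective b {i} {j} {t = t} {u} refl u≈ i≤ j≤ eq | inj₂ j≤i with i ∸ j | m∸n+n≡m j≤i
...   | d | refl with rot-aligned b d j {u} {t} (+-cancelʳ-≤ j _ _ (≤-trans i≤ (≤-reflexive (+-comm j _)))) (sym eq)
...     | refl , u≡t = refl , sym u≡t

iterate-+ : ∀ {A : Set} (f : A → A) m n {x} → iterate f x (m + n) ≡ iterate f (iterate f x m) n
iterate-+ f zero    n = refl
iterate-+ f (suc m) n = iterate-+ f m n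

iterate-suc : ∀ {A : Set} (f : A → A) n {x} → f (iterate f x n) ≡ iterate f x (suc n)
iterate-suc f zero    = refl
iterate-suc f (suc n) = iterate-suc f n

iterate-injective : ∀ {A : Set} {P : A → Set} {f : A → A} → (∀ {x} → P x → P (f x)) →
                    (∀ {x y} → P x → P y → f x ≡ f y → x ≡ y) →
                    ∀ n {x y} → P x → P y → iterate f x n ≡ iterate f y n → x ≡ y
iterate-injective P-f inj zero    px py eq = eq
iterate-injective P-f inj (suc n) px py eq =
  inj px py (iterate-injective P-f inj n (P-f px) (P-f py) eq)

-- Rotation of trees

-- The Dyck word 1u0v becomes u1v0: the root moves to its first child, and the edge just used
-- becomes the last one.
ρ : Tree → Tree
ρ leaf       = leaf
ρ (node t u) = t ⊕ node u leaf

τ : Tree → Tree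
τ (node leaf (node t u)) = node (node leaf t) u
τ (node (node leaf t) u) = node leaf (node t u)
τ t                      = t

τ-involutive : ∀ t → τ (τ t) ≡ t
τ-involutive leaf                            = refl
τ-involutive (node leaf leaf)                = refl
τ-involutive (node leaf (node t u))          = refl
τ-involutive (node (node leaf t) u)          = refl
τ-involutive (node (node (node _ _) _) _)    = refl

size-ρ : ∀ t → size (ρ t) ≡ size t
size-ρ leaf       = refl
size-ρ (node t u) = trans (size-⊕ t (node u leaf)) (trans (+-suc (size t) (size u + 0))
                      (cong (λ n → suc (size t + n)) (+-identityʳ (size u))))

size-τ : ∀ t → size (τ t) ≡ size t
size-τ leaf                            = refl
size-τ (node leaf leaf)                = refl
size-τ (node leaf (node t u))          = refl
size-τ (node (node leaf t) u)          = refl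
size-τ (node (node (node _ _) _) _)    = refl

-- The contour of t has 2 * size t steps, each moving the root along an edge.
ρ-contour : ∀ t u → iterate ρ (t ⊕ u) (size t + size t) ≡ u ⊕ t
ρ-contour leaf       u = sym (⊕-identityʳ u)
ρ-contour (node t s) u = begin
  iterate ρ (node t (s ⊕ u)) (suc (size t + size s) + suc (size t + size s))
    ≡⟨ cong (iterate ρ (node t (s ⊕ u))) (steps (size t) (size s)) ⟩
  iterate ρ (t ⊕ node (s ⊕ u) leaf) ((size t + size t) + suc (size s + size s))
    ≡⟨ iterate-+ ρ (size t + size t) (suc (size s + size s)) ⟩
  iterate ρ (iterate ρ (t ⊕ node (s ⊕ u) leaf) (size t + size t)) (suc (size s + size s))
    ≡⟨ cong (λ x → iterate ρ x (suc (size s + size s))) (ρ-contour t (node (s ⊕ u) leaf)) ⟩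
  iterate ρ ((s ⊕ u) ⊕ node t leaf) (size s + size s)
    ≡⟨ cong (λ x → iterate ρ x (size s + size s)) (⊕-assoc s u (node t leaf)) ⟩
  iterate ρ (s ⊕ (u ⊕ node t leaf)) (size s + size s)
    ≡⟨ ρ-contour s (u ⊕ node t leaf) ⟩
  (u ⊕ node t leaf) ⊕ s
    ≡⟨ ⊕-assoc u (node t leaf) s ⟩
  u ⊕ node t s ∎
  where
  open ≡-Reasoning
  steps : ∀ a b → suc (a + b) + suc (a + b) ≡ suc ((a + a) + suc (b + b))
  steps = solve-∀

ρ-period : ∀ {n} t → size t ≡ n → iterate ρ t (n + n) ≡ t
ρ-period t refl = trans (cong (λ x → iterate ρ x (size t + size t)) (sym (⊕-identityʳ t))) (ρ-contour t leaf)

-- Connectivity of the ordered trees of one size under ρ and τ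

infix 4 _~_ _↝_

data _~_ : Tree → Tree → Set where
  ~-ρ     : ∀ t → t ~ ρ t
  ~-τ     : ∀ t → t ~ τ t
  ~-refl  : ∀ {t} → t ~ t
  ~-sym   : ∀ {t u} → t ~ u → u ~ t
  ~-trans : ∀ {t u s} → t ~ u → u ~ s → t ~ s

~-reflexive : ∀ {t u} → t ≡ u → t ~ u
~-reflexive refl = ~-refl

data _↝_ : Tree → Tree → Set where
  pull : ∀ t u → node (node leaf t) u ↝ node leaf (node t u)
  deep : ∀ {t s} u → t ↝ s → node t u ↝ node s u

-- `τ` acts only at the root. For a move inside the first subtree, `ρ` brings this subtree to the
-- root, with everything else to its right; after the move `ρ` is undone. The context `w` is what
-- the induction needs to absorb that rest.
↝⇒~ : ∀ {t s} → t ↝ s → ∀ w → t ⊕ w ~ s ⊕ w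
↝⇒~ (pull t u) w = ~-τ (node (node leaf t) (u ⊕ w))
↝⇒~ (deep {t} {s} u m) w = ~-trans (~-ρ (node t (u ⊕ w)))
  (~-trans (↝⇒~ m (node (u ⊕ w) leaf)) (~-sym (~-ρ (node s (u ⊕ w)))))

data _↝*_ : Tree → Tree → Set where
  stop : ∀ {t} → t ↝* t
  step : ∀ {t u s} → t ↝ u → u ↝* s → t ↝* s

deep* : ∀ {t s} u → t ↝* s → node t u ↝* node s u
deep* u stop       = stop
deep* u (step m r) = step (deep u m) (deep* u r)

_↝*∷_ : ∀ {t u s} → t ↝* u → u ↝ s → t ↝* s
stop     ↝*∷ m = step m stop
step n r ↝*∷ m = step n (r ↝*∷ m)

↝*⇒~ : ∀ {t s} → t ↝* s → ∀ w → t ⊕ w ~ s ⊕ w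
↝*⇒~ stop       w = ~-refl
↝*⇒~ (step m r) w = ~-trans (↝⇒~ m w) (↝*⇒~ r w)

pull-leaf : ∀ t u → ∃ λ s → (node t u ↝* node leaf s) × size s ≡ size t + size u
pull-leaf leaf       u = u , stop , refl
pull-leaf (node t v) u with pull-leaf t v
... | s , r , s≡ = node s u , (deep* u r ↝*∷ pull s u) , cong (λ n → suc (n + size u)) s≡

star : ℕ → Tree
star zero    = leaf
star (suc n) = node leaf (star n)

size-star : ∀ n → size (star n) ≡ n
size-star zero    = refl
size-star (suc n) = cong suc (size-star n)

star-snoc : ∀ n → star n ⊕ node leaf leaf ≡ star (suc n)
star-snoc zero    = refl
star-snoc (suc n) = cong (node leaf) (star-snoc n)

-- Pull a leaf to the front, then rotate twice: `node leaf x` becomes `node x leaf` and then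
-- `x ⊕ node leaf leaf`. The star at the end gains a leaf while the part before it loses an edge.
~-star-⊕ : ∀ n t j → size t ≡ n → t ⊕ star j ~ star (n + j)
~-star-⊕ zero    leaf       j eq = ~-refl
~-star-⊕ (suc n) (node t u) j eq with pull-leaf t u
... | s , r , s≡ = ~-trans (↝*⇒~ r (star j)) (~-trans (~-ρ _) (~-trans (~-ρ _) (~-trans
        (~-reflexive (trans (⊕-assoc s (star j) (node leaf leaf)) (cong (s ⊕_) (star-snoc j))))
        (~-trans (~-star-⊕ n s (suc j) (trans s≡ (suc-injective eq)))
                 (~-reflexive (cong star (+-suc n j)))))))

~-star : ∀ t → t ~ star (size t)
~-star t = subst₂ _~_ (⊕-identityʳ t) (cong star (+-identityʳ (size t))) (~-star-⊕ (size t) t 0 refl)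

-- Closure under inverses comes for free: `ρ` is periodic on trees of one size, so its inverse is
-- one of its iterates, and `τ` is an involution.
~-closed : ∀ {S : Tree → Set} → (∀ {t} → S t → S (ρ t)) → (∀ {t} → S t → S (τ t)) →
           ∀ {t u} → t ~ u → (S t → S u) × (S u → S t)
~-closed {S} S-ρ S-τ = go
  where
  S-iterate : ∀ n {t} → S t → S (iterate ρ t n)
  S-iterate zero    st = st
  S-iterate (suc n) st = S-iterate n (S-ρ st)
  S-ρ⁻¹ : ∀ t → S (ρ t) → S t
  S-ρ⁻¹ leaf         st = st
  S-ρ⁻¹ t@(node a b) st = subst S (ρ-period t refl) (S-iterate (size a + size b + suc (size a + size b)) st)
  go : ∀ {t u} → t ~ u → (S t → S u) × (S u → S t)
  go (~-ρ t)       = S-ρ , S-ρ⁻¹ t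
  go (~-τ t)       = S-τ , subst S (τ-involutive t) ∘ S-τ
  go ~-refl        = id , id
  go (~-sym r)     = proj₂ (go r) , proj₁ (go r)
  go (~-trans r s) = proj₁ (go s) ∘ proj₁ (go r) , proj₂ (go r) ∘ proj₂ (go s)

ρτ-transitive : ∀ {S : Tree → Set} → (∀ {t} → S t → S (ρ t)) → (∀ {t} → S t → S (τ t)) →
                ∀ {t u} → size t ≡ size u → S t → S u
ρτ-transitive S-ρ S-τ {t} {u} eq = proj₁ (~-closed S-ρ S-τ
  (~-trans (~-star t) (~-trans (~-reflexive (cong star eq)) (~-sym (~-star u)))))

-- Saturating cycles

Pair : Set
Pair = Word × Word

-- A closed walk in two consecutive levels is a cyclic list of pairs, a lower
-- vertex followed by an upper one.
Edge : Pair → Pair → Set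
Edge (l , u) (l′ , _) = l ⋖ u × l′ ⋖ u

⋖-length : ∀ {v w} → v ⋖ w → length v ≡ length w
⋖-length here      = refl
⋖-length (there c) = cong suc (⋖-length c)

⋖-ones : ∀ {v w} → v ⋖ w → suc (ones v) ≡ ones w
⋖-ones here              = refl
⋖-ones (there {true} c)  = cong suc (⋖-ones c)
⋖-ones (there {false} c) = ⋖-ones c

OnLevel : ℕ → ℕ → Word → Set
OnLevel m k w = length w ≡ m × ones w ≡ k

Edge-level : ∀ {m k p q} → Edge p q → OnLevel m k (proj₁ p) → OnLevel m k (proj₁ q)
Edge-level (c , c′) (len , o) = trans (⋖-length c′) (trans (sym (⋖-length c)) len)
                              , trans (suc-injective (trans (⋖-ones c′) (sym (⋖-ones c)))) o

record Saturating (m k : ℕ) : Set where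
  field
    first         : Pair
    others        : List Pair
    walk          : Walk Edge first others first
    level         : OnLevel m k (proj₁ first)
    lowers-unique : Unique (map proj₁ (first ∷ others))
    uppers-unique : Unique (map proj₂ (first ∷ others))
    lowers-cover  : ∀ {w} → OnLevel m k w → w ∈ map proj₁ (first ∷ others)

-- Trajectories of ρ

-- The index counts down while the tree rotates, since each application of `ρ` absorbs one cyclic
-- shift of the word. Index and number of steps taken determine each other.
Trace : {A : Set} → (ℕ → Tree → A) → ℕ → Tree → List A
Trace L zero    t = []
Trace L (suc s) t = L s t ∷ Trace L s (ρ t)

map-Trace : ∀ {A B : Set} (f : A → B) (L : ℕ → Tree → A) s t →
            map f (Trace L s t) ≡ Trace (λ i u → f (L i u)) s t
map-Trace f L zero    t = refl
map-Trace f L (suc s) t = cong (f (L s t) ∷_) (map-Trace f L s (ρ t))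

length-Trace : ∀ {A : Set} (L : ℕ → Tree → A) s t → length (Trace L s t) ≡ s
length-Trace L zero    t = refl
length-Trace L (suc s) t = cong suc (length-Trace L s (ρ t))

∈-Trace⁻ : ∀ {A : Set} {L : ℕ → Tree → A} s {t x} → x ∈ Trace L s t →
           ∃₂ λ i j → suc i + j ≡ s × x ≡ L i (iterate ρ t j)
∈-Trace⁻ (suc s) (here refl) = s , 0 , cong suc (+-identityʳ s) , refl
∈-Trace⁻ (suc s) (there x∈) with ∈-Trace⁻ s x∈
... | i , j , eq , eq′ = i , suc j , trans (cong suc (+-suc i j)) (cong suc eq) , eq′

∈-Trace⁺ : ∀ {A : Set} {L : ℕ → Tree → A} i j {t} → L i (iterate ρ t j) ∈ Trace L (suc (j + i)) t
∈-Trace⁺ i zero    = here refl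
∈-Trace⁺ i (suc j) = there (∈-Trace⁺ i j)

lower upper : ℕ → Tree → Word
lower s t = rot s (str t ∷ʳ false)
upper s t = rot s (str (ρ t) ∷ʳ true)

-- Turning the first edge 1u0 of a tree 1u0v around goes through the words
-- 1u0v0, 1u1v0, 0u1v0, the last of which is u1v00 rotated.
run : ℕ → Tree → List Pair
run = Trace (λ s t → lower (suc s) t , upper s t)

turn-⋖ : ∀ t u → (str t ++ false ∷ str u) ∷ʳ false ⋖ str (t ⊕ node u leaf)
turn-⋖ t u = subst₂ _⋖_ (sym (++-assoc (str t) (false ∷ str u) [ false ])) (sym (str-⊕ t (node u leaf)))
               (⋖-++ˡ (str t) here)

lower⋖upper : ∀ s t {n} → size t ≡ suc n → lower (suc s) t ⋖ upper s t
lower⋖upper s (node t u) _ = rot-⋖ (suc s) (there {true} (turn-⋖ t u))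

next⋖upper : ∀ s t → lower s (ρ t) ⋖ upper s t
next⋖upper s t = rot-⋖ s (⋖-++ˡ (str (ρ t)) here)

run-walk : ∀ s t {n p q} → size t ≡ suc n → proj₁ p ⋖ proj₂ p → lower s t ⋖ proj₂ p →
           proj₁ q ≡ lower 0 (iterate ρ t s) → Walk Edge p (run s t) q
run-walk zero    t pt c₁ c₂ eq = last (c₁ , subst (_⋖ _) (sym eq) c₂)
run-walk (suc s) t pt c₁ c₂ eq = (c₁ , c₂) ∷
  run-walk s (ρ t) (trans (size-ρ t) pt) (lower⋖upper s t pt) (next⋖upper s t) eq

-- The middle levels cycle

module MiddleLevels (e : ℕ) where

  -- `N` is the word length 2n+1, one more than the period 2n of `ρ`; hence `run N t` leads to the
  -- first word of `run N (ρ t)`. The form `3 + c` exposes the three pairs that a gluing rearranges.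
  n c N : ℕ
  n = suc e
  c = e + e
  N = 3 + c

  N≡ : N ≡ suc (n + n)
  N≡ = cong (2 +_) (sym (+-suc e e))

  P : Tree → Set
  P t = size t ≡ n

  P-ρ : ∀ {t} → P t → P (ρ t)
  P-ρ {t} pt = trans (size-ρ t) pt

  P-τ : ∀ {t} → P t → P (τ t)
  P-τ {t} pt = trans (size-τ t) pt

  P-iterate : ∀ j {t} → P t → P (iterate ρ t j)
  P-iterate zero    pt = pt
  P-iterate (suc j) {t} pt = P-iterate j (P-ρ {t} pt)

  ρ-injective : ∀ {t u} → P t → P u → ρ t ≡ ρ u → t ≡ u
  ρ-injective {t} {u} pt pu eq = trans (sym (ρ-period t pt))
    (trans (cong (λ x → iterate ρ x (e + n)) eq) (ρ-period u pu))

  ρ-surjective : ∀ j {t} → P t → ∃ λ u → P u × iterate ρ u j ≡ t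
  ρ-surjective zero    {t} pt = t , pt , refl
  ρ-surjective (suc j) {t} pt with ρ-surjective j pt
  ... | u , pu , eq = iterate ρ u (e + n) , P-iterate (e + n) pu
                    , trans (cong (λ x → iterate ρ x j) (trans (iterate-suc ρ (e + n)) (ρ-period u pu))) eq

  bounded : ∀ {ts} → Unique ts → All P ts → length ts ≤ length (choose (n + n) n)
  bounded {ts} u ps = subst (_≤ _) (length-map str ts)
    (Unique-⊆⇒length≤ (Uniqueₚ.map⁺ str-injective u) sub)
    where
    sub : map str ts ⊆ choose (n + n) n
    sub w∈ with ∈-map⁻ str w∈
    ... | t , t∈ , refl = subst₂ (λ l k → str t ∈ choose l k)
      (trans (length-str t) (cong₂ _+_ pt pt)) (trans (ones-str t) pt) (∈-choose (str t))
      where pt = All.lookup ps t∈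

  open Twisting P (length (choose (n + n) n)) bounded _≟_ ρ τ (λ {t} → P-ρ {t}) (λ {t} → P-τ {t}) ρ-injective τ-involutive

  -- The two paths through a pair t, τ t of glued trees.  They differ from run N
  -- by the 6-cycle on the words that agree with 1∗∗u∗v0 outside the stars.
  glued : Bool → Tree → Word × List Pair
  glued true t@(node (node leaf _) _) = upper (2 + c) (τ t) , run (2 + c) (ρ (τ t))
  glued true t@(node leaf (node _ _)) = upper c t₂
    , (lower (1 + c) t₂ , upper (1 + c) t₁) ∷ (lower (2 + c) t₁ , upper (2 + c) t₀) ∷ run c (ρ t₂)
    where
    t₀ = τ t
    t₁ = ρ t₀
    t₂ = ρ t₁
  glued _ t = upper (2 + c) t , run (2 + c) (ρ t)

  head : Bool → Tree → Pair
  head b t = lower N t , proj₁ (glued b t)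

  path : Bool → Tree → List Pair
  path b t = head b t ∷ proj₂ (glued b t)

  length-∷ʳ-str : ∀ t b → P t → length (str t ∷ʳ b) ≡ suc (n + n)
  length-∷ʳ-str t b pt = trans (length-∷ʳ (str t) b) (cong suc (trans (length-str t) (cong₂ _+_ pt pt)))

  lower-level : ∀ {s} t → P t → OnLevel (suc (n + n)) n (lower s t)
  lower-level {s} t pt = trans (length-rot s (str t ∷ʳ false)) (length-∷ʳ-str t false pt)
    , trans (ones-rot s (str t ∷ʳ false))
        (trans (ones-++ (str t) [ false ]) (trans (+-identityʳ _) (trans (ones-str t) pt)))

  lower-N : ∀ {t} → P t → lower N t ≡ lower 0 t
  lower-N {t} pt = trans
    (cong (λ l → rot l (str t ∷ʳ false)) (trans N≡ (sym (length-∷ʳ-str t false pt))))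
    (rot-length (str t ∷ʳ false))

  lower-return : ∀ t → P t → lower N (ρ t) ≡ lower 0 (iterate ρ t N)
  lower-return t pt = trans (lower-N {ρ t} (P-ρ {t} pt)) (cong (lower 0) (sym (trans
    (cong (iterate ρ t) N≡) (ρ-period (ρ t) (P-ρ {t} pt)))))

  str-⊕-leaf : ∀ t → str (t ⊕ node leaf leaf) ≡ (str t ∷ʳ true) ∷ʳ false
  str-⊕-leaf t = trans (str-⊕ t (node leaf leaf)) (sym (++-assoc (str t) [ true ] [ false ]))

  run-walk-N : ∀ t {q} → P t → proj₁ q ≡ lower N (ρ t) →
               Walk Edge (lower N t , upper (2 + c) t) (run (2 + c) (ρ t)) q
  run-walk-N t pt eq = run-walk (2 + c) (ρ t) (P-ρ {t} pt) (lower⋖upper (2 + c) t pt)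
    (next⋖upper (2 + c) t) (trans eq (lower-return t pt))

  -- A glued block of t ends where the block of `τ t` used to end, which is why its successor is
  -- `ρ (τ t)`. For t = 110u0v, one new edge leads straight to the first upper word of the run of
  -- `τ t`. Where `τ t` is t, nothing changes.
  path-walk : ∀ b {t q} → P t → proj₁ q ≡ lower N (ρ (if b then τ t else t)) →
              Walk Edge (head b t) (proj₂ (glued b t)) q
  path-walk false {t} pt eq = run-walk-N t pt eq
  path-walk true {node leaf leaf} pt eq = run-walk-N (node leaf leaf) pt eq
  path-walk true {t@(node (node (node _ _) _) _)} pt eq = run-walk-N t pt eq
  path-walk true {t@(node (node leaf u) v)} pt eq = run-walk (2 + c) (ρ (τ t)) (P-ρ {τ t} pt)
    (rot-⋖ N (there {true} (there {true} (here {(str u ++ false ∷ str v) ∷ʳ false}))))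
    (next⋖upper (2 + c) (τ t)) (trans eq (lower-return (τ t) pt))
  -- For t = 101u0v, the edge `outer` enters the run of t₀ at its third upper word; the run is
  -- followed backwards to its first upper word, and the edge `inner` skips ahead to the part behind
  -- the third pair.
  path-walk true {t@(node leaf (node u v))} pt eq =
    (outer , lower⋖upper c t₂ p₂) ∷
    (next⋖upper (1 + c) t₁ , lower⋖upper (1 + c) t₁ p₁) ∷
    run-walk c (ρ t₂) (P-ρ {t₂} p₂) (next⋖upper (2 + c) t₀) inner (trans eq (lower-return t₀ pt))
    where
    t₀ = τ t
    t₁ = ρ t₀
    t₂ = ρ t₁
    p₁ : P t₁
    p₁ = P-ρ {t₀} pt
    p₂ : P t₂
    p₂ = P-ρ {t₁} p₁
    w = u ⊕ node v leaf
    outer : lower N t ⋖ upper c t₂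
    outer = subst (λ x → lower N t ⋖ rot c (x ∷ʳ true)) (sym (str-⊕-leaf w))
      (rot-⋖ N (there {true} (there {false} (there {true} (turn-⋖ u v)))))
    inner : lower c (ρ t₂) ⋖ upper (2 + c) t₀
    inner = subst (λ x → rot c (x ∷ʳ false) ⋖ upper (2 + c) t₀) (sym (str-⊕-leaf w))
      (rot-⋖ N (there {true} (here {false ∷ str w})))

  length-path : ∀ b t → length (path b t) ≡ N
  length-path false t                           = length-Trace _ N t
  length-path true leaf                         = length-Trace _ N leaf
  length-path true (node leaf leaf)             = length-Trace _ N (node leaf leaf)
  length-path true (node leaf (node u v))       = cong (3 +_) (length-Trace _ c _)
  length-path true (node (node leaf u) v)       = cong suc (length-Trace _ (2 + c) (node (node u v) leaf))
  length-path true t@(node (node (node _ _) _) _) = length-Trace _ N t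

  -- Only this inclusion is checked by cases. As glued and original blocks have the same length,
  -- counting in `routes-unique` then excludes repetitions.
  lowers-recovered : ∀ b t {w} → w ∈ map proj₁ (run N t) →
                     w ∈ map proj₁ (path b t) ⊎ w ∈ map proj₁ (path b (τ t))
  lowers-recovered false t w∈ = inj₁ w∈
  lowers-recovered true leaf w∈ = inj₁ w∈
  lowers-recovered true (node leaf leaf) w∈ = inj₁ w∈
  lowers-recovered true (node (node (node _ _) _) _) w∈ = inj₁ w∈
  lowers-recovered true (node leaf (node u v)) (here eq)  = inj₁ (here eq)
  lowers-recovered true (node leaf (node u v)) (there w∈) = inj₂ (there w∈)
  lowers-recovered true (node (node leaf u) v) (here eq)  = inj₁ (here eq)
  lowers-recovered true (node (node leaf u) v) (there (here eq)) = inj₂ (there (there (here eq)))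
  lowers-recovered true (node (node leaf u) v) (there (there (here eq))) = inj₂ (there (here eq))
  lowers-recovered true (node (node leaf u) v) (there (there (there w∈))) = inj₂ (there (there (there w∈)))

  uppers-recovered : ∀ b t {w} → w ∈ map proj₂ (run N t) →
                     w ∈ map proj₂ (path b t) ⊎ w ∈ map proj₂ (path b (τ t))
  uppers-recovered false t w∈ = inj₁ w∈
  uppers-recovered true leaf w∈ = inj₁ w∈
  uppers-recovered true (node leaf leaf) w∈ = inj₁ w∈
  uppers-recovered true (node (node (node _ _) _) _) w∈ = inj₁ w∈
  uppers-recovered true (node leaf (node u v)) w∈ = inj₂ w∈
  uppers-recovered true (node (node leaf u) v) (here eq) = inj₂ (there (there (here eq)))
  uppers-recovered true (node (node leaf u) v) (there (here eq)) = inj₂ (there (here eq))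
  uppers-recovered true (node (node leaf u) v) (there (there (here eq))) = inj₂ (here eq)
  uppers-recovered true (node (node leaf u) v) (there (there (there w∈))) = inj₂ (there (there (there w∈)))

  module _ {A : Set} {L : ℕ → Tree → A}
           (L-injective : ∀ {i j t u} → i < N → j < N → P t → P u → L i t ≡ L j u → i ≡ j × t ≡ u)
           where

    Trace-unique : ∀ s {t} → s ≤ N → P t → Unique (Trace L s t)
    Trace-unique zero    s≤ pt = []
    Trace-unique (suc s) {t} s≤ pt = ¬Any⇒All¬ _ s∉ ∷ Trace-unique s (≤-trans (n≤1+n s) s≤) (P-ρ {t} pt)
      where
      s∉ : L s t ∉ Trace L s (ρ t)
      s∉ s∈ with ∈-Trace⁻ s s∈
      ... | i , j , refl , eq
        with L-injective s≤ (≤-trans (s≤s (≤-trans (m≤m+n i j) (n≤1+n _))) s≤) pt (P-iterate j (P-ρ {t} pt)) eq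
      ... | s≡i , _ = m≢1+m+n i (sym s≡i)

    -- A common element has the same index in both trajectories, so both have taken the same number
    -- of steps to the same tree, and these steps can be undone.
    Trace-disjoint : ∀ {t u x} → P t → P u → x ∈ Trace L N t → x ∈ Trace L N u → t ≡ u
    Trace-disjoint {t} {u} pt pu x∈t x∈u with ∈-Trace⁻ N x∈t | ∈-Trace⁻ N x∈u
    ... | i , j , eq , refl | i′ , j′ , eq′ , x≡
      with L-injective (subst (i <_) eq (m≤m+n (suc i) j)) (subst (i′ <_) eq′ (m≤m+n (suc i′) j′))
             (P-iterate j pt) (P-iterate j′ pu) x≡
    ... | refl , it≡ with +-cancelˡ-≡ (suc i) j j′ (trans eq (sym eq′))
    ... | refl = iterate-injective (λ {t} → P-ρ {t}) ρ-injective j pt pu it≡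

    Traces-unique : ∀ {ts} → Unique ts → All P ts → Unique (concatMap (Trace L N) ts)
    Traces-unique []      []        = []
    Traces-unique {t ∷ ts} u@(_ ∷ u′) (pt ∷ ps) =
      Uniqueₚ.++⁺ (Trace-unique N ≤-refl pt) (Traces-unique u′ ps) disjoint
      where
      disjoint : ∀ {x} → x ∈ Trace L N t × x ∈ concatMap (Trace L N) ts → ⊥
      disjoint (x∈t , x∈ts) with find (∈-concatMap⁻ (Trace L N) x∈ts)
      ... | s , s∈ , x∈s =
        Unique⇒∉ u (subst (_∈ ts) (sym (Trace-disjoint pt (All.lookup ps s∈) x∈t x∈s)) s∈)

  within : ∀ {i j} → i < N → i ≤ j + (n + n)
  within {i} {j} i< = ≤-trans (≤-pred (subst (i <_) N≡ i<)) (m≤n+m (n + n) j)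

  lower-injective : ∀ {i j t u} → i < N → j < N → P t → P u →
                    lower (suc i) t ≡ lower (suc j) u → i ≡ j × t ≡ u
  lower-injective {i} {j} i< j< pt pu eq
    with rot-∷ʳ-injective false pt pu (s≤s (within {i} {j} i<)) (s≤s (within {j} {i} j<)) eq
  ... | refl , t≡u = refl , t≡u

  upper-injective : ∀ {i j t u} → i < N → j < N → P t → P u → upper i t ≡ upper j u → i ≡ j × t ≡ u
  upper-injective {i} {j} {t} {u} i< j< pt pu eq
    with rot-∷ʳ-injective true (P-ρ {t} pt) (P-ρ {u} pu) (within {i} {j} i<) (within {j} {i} j<) eq
  ... | i≡j , eq′ = i≡j , ρ-injective pt pu eq′

  module Assembly (χ : Tree → Bool) (inv : Invariant χ) (t₀ : Tree) (ts : List Tree)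
           (cycle : TwistedCycle χ t₀ ts) (complete : ∀ {t} → P t → t ∈ t₀ ∷ ts) where

    route : Tree → List Pair
    route t = path (χ t) t

    P-all : All P (t₀ ∷ ts)
    P-all = proj₂ (proj₂ cycle)

    routes-walk : ∀ {t u us} → Walk (Step (ρ ∘ twist χ)) t us u → All P (t ∷ us) →
                  Walk Edge (head (χ t) t) (proj₂ (glued (χ t) t) ++ concatMap route us) (head (χ u) u)
    routes-walk {t} {u} (last eq) (pt ∷ _) = subst (λ ps → Walk Edge (head (χ t) t) ps (head (χ u) u))
      (sym (++-identityʳ _)) (path-walk (χ t) pt (cong (lower N) eq))
    routes-walk {t} (eq ∷ w) (pt ∷ ps) = path-walk (χ t) pt (cong (lower N) eq) ++ʷ routes-walk w ps

    module _ (f : Pair → Word) (L : ℕ → Tree → Word) (f-run : ∀ s t → map f (run s t) ≡ Trace L s t)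
             (L-injective : ∀ {i j t u} → i < N → j < N → P t → P u → L i t ≡ L j u → i ≡ j × t ≡ u)
             (recovered : ∀ b t {w} → w ∈ map f (run N t) → w ∈ map f (path b t) ⊎ w ∈ map f (path b (τ t)))
             where

      ∈-routes : ∀ {t w} → P t → w ∈ map f (route t) → w ∈ map f (concatMap route (t₀ ∷ ts))
      ∈-routes {t} pt w∈ with ∈-map⁻ f w∈
      ... | x , x∈ , refl = ∈-map⁺ f (∈-concatMap⁺ route (lose (complete pt) x∈))

      Trace-⊆ : ∀ {t} → P t → Trace L N t ⊆ map f (concatMap route (t₀ ∷ ts))
      Trace-⊆ {t} pt {w} w∈ with recovered (χ t) t (subst (w ∈_) (sym (f-run N t)) w∈)
      ... | inj₁ w∈₁ = ∈-routes pt w∈₁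
      ... | inj₂ w∈₂ = ∈-routes (P-τ {t} pt) (subst (λ b → w ∈ map f (path b (τ t))) (sym (inv t)) w∈₂)

      length-routes : ∀ us → length (concatMap route us) ≡ length (concatMap (Trace L N) us)
      length-routes []       = refl
      length-routes (t ∷ us) = trans (length-++ (route t)) (trans
        (cong₂ _+_ (trans (length-path (χ t) t) (sym (length-Trace L N t))) (length-routes us))
        (sym (length-++ (Trace L N t))))

      routes-unique : Unique (map f (concatMap route (t₀ ∷ ts)))
      routes-unique = Unique-⊆⇒Unique (Traces-unique L-injective (proj₁ (proj₂ cycle)) P-all) sub
        (≤-reflexive (trans (length-map f (concatMap route (t₀ ∷ ts))) (length-routes (t₀ ∷ ts))))
        where
        sub : concatMap (Trace L N) (t₀ ∷ ts) ⊆ map f (concatMap route (t₀ ∷ ts))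
        sub w∈ with find (∈-concatMap⁻ (Trace L N) {xs = t₀ ∷ ts} w∈)
        ... | t , t∈ , w∈t = Trace-⊆ (All.lookup P-all t∈) w∈t

    lowers-run : ∀ s t → map proj₁ (run s t) ≡ Trace (λ i → lower (suc i)) s t
    lowers-run = map-Trace proj₁ _

    uppers-run : ∀ s t → map proj₂ (run s t) ≡ Trace upper s t
    uppers-run = map-Trace proj₂ _

    cover : ∀ {w} → OnLevel (suc (n + n)) n w → w ∈ map proj₁ (concatMap route (t₀ ∷ ts))
    cover {w} (len , o) with cycle-lemma w zeros≡
      where
      zeros≡ : zeros w ≡ suc (ones w)
      zeros≡ = +-cancelˡ-≡ (ones w) _ _ (trans (ones+zeros w) (trans len
        (trans (sym (+-suc n n)) (cong (λ k → k + suc k) (sym o)))))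
    -- Index s is reached after `N ∸ suc s` steps, so the block containing w is that of the tree
    -- this many steps before t.
    ... | t , s , s< , refl with ρ-surjective (N ∸ suc s) pt
      where
      pt : P t
      pt = trans (sym (ones-str t)) (trans (sym (trans (ones-++ (str t) [ false ]) (+-identityʳ _)))
             (trans (sym (ones-rot (suc s) (str t ∷ʳ false))) o))
    ... | u , pu , refl = Trace-⊆ proj₁ _ lowers-run lower-injective lowers-recovered pu
      (subst (λ m → lower (suc s) (iterate ρ u (N ∸ suc s)) ∈ Trace (λ i → lower (suc i)) m u)
        (trans (sym (+-suc (N ∸ suc s) s)) (m∸n+n≡m (subst (suc s ≤_) (trans len (sym N≡)) s<)))
        (∈-Trace⁺ s (N ∸ suc s)))

  saturating : Saturating (suc (n + n)) n
  saturating with closedCycle {star n} (size-star n)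
  ... | χ , t₀ , ts , inv , cyc , ρ-cl , τ-cl = record
    { first = head (χ t₀) t₀
    ; others = proj₂ (glued (χ t₀) t₀) ++ concatMap route ts
    ; walk = routes-walk (proj₁ cyc) P-all
    ; level = lower-level {N} t₀ (All.lookup P-all (here refl))
    ; lowers-unique = routes-unique proj₁ _ lowers-run lower-injective lowers-recovered
    ; uppers-unique = routes-unique proj₂ _ uppers-run upper-injective uppers-recovered
    ; lowers-cover = cover
    }
    where
    open Assembly χ inv t₀ ts cyc
           -- The trees on the closed cycle form a nonempty set closed under `ρ` and `τ`, hence are
           -- all trees with n edges.
           (λ pt → ρτ-transitive ρ-cl τ-cl (trans (All.lookup (proj₂ (proj₂ cyc)) (here refl)) (sym pt)) (here refl))

-- Symmetries of the cube

record Symmetry : Set where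
  field
    to from    : Word → Word
    from-to    : ∀ w → from (to w) ≡ w
    to-from    : ∀ w → to (from w) ≡ w
    to-⋖       : ∀ {v w} → v ⋖ w → to v ⋖ to w
    from-⋖     : ∀ {v w} → v ⋖ w → from v ⋖ from w
    to-length  : ∀ w → length (to w) ≡ length w
    to-ones    : ∀ w → ones (to w) ≡ ones w

  from-length : ∀ w → length (from w) ≡ length w
  from-length w = trans (sym (to-length (from w))) (cong length (to-from w))

  from-ones : ∀ w → ones (from w) ≡ ones w
  from-ones w = trans (sym (to-ones (from w))) (cong ones (to-from w))

  to-level : ∀ {m k} w → OnLevel m k w → OnLevel m k (to w)
  to-level w (len , o) = trans (to-length w) len , trans (to-ones w) o

  from-level : ∀ {m k} w → OnLevel m k w → OnLevel m k (from w)
  from-level w (len , o) = trans (from-length w) len , trans (from-ones w) o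

  to-injective : ∀ {v w} → to v ≡ to w → v ≡ w
  to-injective {v} {w} eq = trans (sym (from-to v)) (trans (cong from eq) (from-to w))

open Symmetry

identity : Symmetry
identity = record
  { to = id ; from = id ; from-to = λ _ → refl ; to-from = λ _ → refl
  ; to-⋖ = id ; from-⋖ = id ; to-length = λ _ → refl ; to-ones = λ _ → refl }

inverse : Symmetry → Symmetry
inverse π = record
  { to = from π ; from = to π ; from-to = to-from π ; to-from = from-to π
  ; to-⋖ = from-⋖ π ; from-⋖ = to-⋖ π ; to-length = from-length π ; to-ones = from-ones π }

infixr 5 _⨾_

_⨾_ : Symmetry → Symmetry → Symmetry
π ⨾ σ = record
  { to = to σ ∘ to π ; from = from π ∘ from σ
  ; from-to = λ w → trans (cong (from π) (from-to σ (to π w))) (from-to π w)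
  ; to-from = λ w → trans (cong (to σ) (to-from π (from σ w))) (to-from σ w)
  ; to-⋖ = to-⋖ σ ∘ to-⋖ π ; from-⋖ = from-⋖ π ∘ from-⋖ σ
  ; to-length = λ w → trans (to-length σ (to π w)) (to-length π w)
  ; to-ones = λ w → trans (to-ones σ (to π w)) (to-ones π w) }

onTail : (Word → Word) → Word → Word
onTail f []      = []
onTail f (b ∷ w) = b ∷ f w

onTail-length : ∀ {f} → (∀ w → length (f w) ≡ length w) → ∀ w → length (onTail f w) ≡ length w
onTail-length eq []      = refl
onTail-length eq (b ∷ w) = cong suc (eq w)

onTail-ones : ∀ {f} → (∀ w → ones (f w) ≡ ones w) → ∀ w → ones (onTail f w) ≡ ones w
onTail-ones eq []          = refl
onTail-ones eq (true ∷ w)  = cong suc (eq w)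
onTail-ones eq (false ∷ w) = eq w

onTail-inverse : ∀ {f g : Word → Word} → (∀ w → g (f w) ≡ w) → ∀ w → onTail g (onTail f w) ≡ w
onTail-inverse gf []      = refl
onTail-inverse gf (b ∷ w) = cong (b ∷_) (gf w)

onTail-⋖ : ∀ {f} → (∀ {v w} → v ⋖ w → f v ⋖ f w) → ∀ {v w} → v ⋖ w → onTail f v ⋖ onTail f w
onTail-⋖ f-⋖ here      = here
onTail-⋖ f-⋖ (there c) = there (f-⋖ c)

lift : Symmetry → Symmetry
lift π = record
  { to = onTail (to π) ; from = onTail (from π)
  ; from-to = onTail-inverse (from-to π) ; to-from = onTail-inverse (to-from π)
  ; to-⋖ = onTail-⋖ (to-⋖ π) ; from-⋖ = onTail-⋖ (from-⋖ π)
  ; to-length = onTail-length (to-length π) ; to-ones = onTail-ones (to-ones π) }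

exchange : Word → Word
exchange (a ∷ b ∷ w) = b ∷ a ∷ w
exchange w           = w

exchange-involutive : ∀ w → exchange (exchange w) ≡ w
exchange-involutive []          = refl
exchange-involutive (_ ∷ [])    = refl
exchange-involutive (_ ∷ _ ∷ _) = refl

exchange-⋖ : ∀ {v w} → v ⋖ w → exchange v ⋖ exchange w
exchange-⋖ (here {[]})       = here
exchange-⋖ (here {_ ∷ _})    = there here
exchange-⋖ (there here)      = here
exchange-⋖ (there (there c)) = there (there c)

exchange-length : ∀ w → length (exchange w) ≡ length w
exchange-length []          = refl
exchange-length (_ ∷ [])    = refl
exchange-length (_ ∷ _ ∷ _) = refl

exchange-ones : ∀ w → ones (exchange w) ≡ ones w
exchange-ones []                  = refl
exchange-ones (_ ∷ [])            = refl
exchange-ones (true ∷ true ∷ _)   = refl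
exchange-ones (true ∷ false ∷ _)  = refl
exchange-ones (false ∷ true ∷ _)  = refl
exchange-ones (false ∷ false ∷ _) = refl

transposition : Symmetry
transposition = record
  { to = exchange ; from = exchange ; from-to = exchange-involutive ; to-from = exchange-involutive
  ; to-⋖ = exchange-⋖ ; from-⋖ = exchange-⋖ ; to-length = exchange-length ; to-ones = exchange-ones }

sorted : ℕ → ℕ → Word
sorted zero    k       = []
sorted (suc m) zero    = false ∷ sorted m zero
sorted (suc m) (suc k) = true ∷ sorted m k

sink : ∀ m k → k ≤ m → ∃ λ π → to π (false ∷ sorted m k) ≡ sorted (suc m) k
sink m       zero    k≤m       = identity , refl
sink (suc m) (suc k) (s≤s k≤m) with sink m k k≤m
... | π , eq = transposition ⨾ lift π , cong (true ∷_) eq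

ones≤length : ∀ w → ones w ≤ length w
ones≤length w = subst (ones w ≤_) (ones+zeros w) (m≤m+n (ones w) (zeros w))

sort : ∀ w → ∃ λ π → to π w ≡ sorted (length w) (ones w)
sort []          = identity , refl
sort (true ∷ w)  with sort w
... | π , eq = lift π , cong (true ∷_) eq
sort (false ∷ w) with sort w | sink (length w) (ones w) (ones≤length w)
... | π , eq | σ , eq′ = lift π ⨾ σ , trans (cong (to σ ∘ (false ∷_)) eq) eq′

level-transitive : ∀ {m k v w} → OnLevel m k v → OnLevel m k w → ∃ λ π → to π v ≡ w
level-transitive {v = v} {w} (refl , refl) (len , o) with sort v | sort w
... | π , eq | σ , eq′ = π ⨾ inverse σ , trans (cong (from σ) (trans eq
        (trans (sym (cong₂ sorted len o)) (sym eq′)))) (from-to σ w)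

to-front : ∀ {v w} → v ⋖ w → ∃₂ λ π r → to π v ≡ false ∷ r × to π w ≡ true ∷ r
to-front (here {w}) = identity , w , refl , refl
to-front (there {b} c) with to-front c
... | π , r , eq , eq′ = lift π ⨾ transposition , b ∷ r
                       , cong (λ x → exchange (b ∷ x)) eq , cong (λ x → exchange (b ∷ x)) eq′

normalise-below : ∀ {v v′ u} → v ⋖ u → v′ ⋖ u → v ≢ v′ →
                  ∃₂ λ π r → to π v ≡ true ∷ false ∷ r × to π v′ ≡ false ∷ true ∷ r
normalise-below {v} {v′} {u} c c′ v≢v′ with to-front c
... | π , r , eq , eq′ with to π v′ in eq″ | subst (to π v′ ⋖_) eq′ (to-⋖ π c′)
...   | _ | here = contradiction (to-injective π (trans eq (sym eq″))) v≢v′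
...   | _ | there d with to-front d
...     | σ , s , eq₁ , eq₂ = π ⨾ lift σ ⨾ transposition , s
          , cong exchange (trans (cong (onTail (to σ)) eq) (cong (false ∷_) eq₂))
          , cong exchange (trans (cong (onTail (to σ)) eq″) (cong (true ∷_) eq₁))

normalise-above : ∀ {v v′ u} → u ⋖ v → u ⋖ v′ → v ≢ v′ →
                  ∃₂ λ π r → to π v ≡ true ∷ false ∷ r × to π v′ ≡ false ∷ true ∷ r
normalise-above {v} {v′} {u} c c′ v≢v′ with to-front c
... | π , r , eq , eq′ with to π v′ in eq″ | subst (_⋖ to π v′) eq (to-⋖ π c′)
...   | _ | here = contradiction (to-injective π (trans eq′ (sym eq″))) v≢v′
...   | _ | there d with to-front d
...     | σ , s , eq₁ , eq₂ = π ⨾ lift σ , s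
          , trans (cong (onTail (to σ)) eq′) (cong (true ∷_) eq₁)
          , trans (cong (onTail (to σ)) eq″) (cong (false ∷_) eq₂)

-- Whether the common neighbour lies above or below, the two words of a pair differ in exactly two
-- coordinates. Moving these to the front gives 10r and 01r for one pair, 10s and 01s for the other,
-- and r and s lie on the same level.
neighbours-transitive : ∀ {m k v v′ a y z z′} → OnLevel m k v → OnLevel m k z →
                        v ⋖ a → v′ ⋖ a → v ≢ v′ → y ⋖ z → y ⋖ z′ → z ≢ z′ →
                        ∃ λ π → to π v ≡ z × to π v′ ≡ z′
neighbours-transitive {m} {k} {v} {v′} {z = z} {z′} lv lz cv cv′ v≢ cz cz′ z≢
  with normalise-below cv cv′ v≢ | normalise-above cz cz′ z≢
... | π , r , eq , eq′ | σ , s , eq₁ , eq₁′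
  with level-transitive {v = r} {s} (dropLevel r (subst (OnLevel m k) eq (to-level π v lv)))
                                    (dropLevel s (subst (OnLevel m k) eq₁ (to-level σ z lz)))
  where
  dropLevel : ∀ {m k} w → OnLevel m k (true ∷ false ∷ w) → OnLevel (m ∸ 2) (k ∸ 1) w
  dropLevel w (refl , refl) = refl , refl
... | θ , refl = π ⨾ lift (lift θ) ⨾ inverse σ
    , trans (cong (from σ) (trans (cong (onTail (onTail (to θ))) eq) (sym eq₁))) (from-to σ z)
    , trans (cong (from σ) (trans (cong (onTail (onTail (to θ))) eq′) (sym eq₁′))) (from-to σ z′)

-- Saturating cycles by induction on the dimension

open Saturating

both : (Word → Word) → Pair → Pair
both f (l , u) = f l , f u

map-both : (g : Pair → Word) (f : Word → Word) → (∀ p → g (both f p) ≡ f (g p)) →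
           ∀ ps → map g (map (both f) ps) ≡ map f (map g ps)
map-both g f eq []       = refl
map-both g f eq (p ∷ ps) = cong₂ _∷_ (eq p) (map-both g f eq ps)

lowers-both : ∀ f ps → map proj₁ (map (both f) ps) ≡ map f (map proj₁ ps)
lowers-both f = map-both proj₁ f (λ _ → refl)

uppers-both : ∀ f ps → map proj₂ (map (both f) ps) ≡ map f (map proj₂ ps)
uppers-both f = map-both proj₂ f (λ _ → refl)

Walk-first : ∀ {p ps q} → Walk Edge p ps q → proj₁ p ⋖ proj₂ p
Walk-first (last (c , _)) = c
Walk-first ((c , _) ∷ _)  = c

Walk-both : ∀ {f} → (∀ {v w} → v ⋖ w → f v ⋖ f w) → ∀ {p ps q p′ q′} → Walk Edge p ps q →
            proj₁ p′ ⋖ proj₂ p′ → proj₂ p′ ≡ f (proj₂ p) → proj₁ q′ ≡ f (proj₁ q) →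
            Walk Edge p′ (map (both f) ps) q′
Walk-both f-⋖ (last (_ , c))   c′ refl refl = last (c′ , f-⋖ c)
Walk-both f-⋖ ((_ , c) ∷ w)    c′ refl eq   = (c′ , f-⋖ c) ∷ Walk-both f-⋖ w (f-⋖ (Walk-first w)) refl eq

transport : ∀ {m k} → Symmetry → Saturating m k → Saturating m k
transport π S = record
  { first  = both (to π) (first S)
  ; others = map (both (to π)) (others S)
  ; walk   = Walk-both (to-⋖ π) (walk S) (to-⋖ π (Walk-first (walk S))) refl refl
  ; level  = to-level π (proj₁ (first S)) (level S)
  ; lowers-unique = subst Unique (sym (lowers-both (to π) (first S ∷ others S)))
                      (Uniqueₚ.map⁺ (to-injective π) (lowers-unique S))
  ; uppers-unique = subst Unique (sym (uppers-both (to π) (first S ∷ others S)))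
                      (Uniqueₚ.map⁺ (to-injective π) (uppers-unique S))
  ; lowers-cover  = λ {w} l → subst (w ∈_) (sym (lowers-both (to π) (first S ∷ others S)))
                      (subst (_∈ _) (to-from π w) (∈-map⁺ (to π) (lowers-cover S (from-level π w l))))
  }

rotated : ∀ {m k} (S : Saturating m k) {y} → OnLevel m k y →
          ∃₂ λ z ps → Walk Edge (y , z) ps (y , z) × (first S ∷ others S ↭ (y , z) ∷ ps)
rotated S l with ∈-map⁻ proj₁ (lowers-cover S l)
... | (y , z) , p∈ , refl with Walk-rotate (walk S) p∈
... | ps , w , p = z , ps , w , p

startingAt : ∀ {m k} → (S : Saturating m k) → ∀ {y} → OnLevel m k y →
             Σ (Saturating m k) λ S′ → proj₁ (first S′) ≡ y × (first S ∷ others S ↭ first S′ ∷ others S′)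
startingAt S {y} l with rotated S l
... | z , ps , w , p = record
  { first = y , z ; others = ps ; walk = w ; level = l
  ; lowers-unique = Unique-resp-↭ (↭-map⁺ proj₁ p) (lowers-unique S)
  ; uppers-unique = Unique-resp-↭ (↭-map⁺ proj₂ p) (uppers-unique S)
  ; lowers-cover  = λ l′ → ∈-resp-↭ (↭-map⁺ proj₁ p) (lowers-cover S l′)
  } , refl , p

second : ∀ {m k} (S : Saturating m k) {v w} → OnLevel m k v → OnLevel m k w → v ≢ w →
         ∃₂ λ p ps → others S ≡ p ∷ ps
second S {v} {w} lv lw v≢w with others S | lowers-cover S {v} lv | lowers-cover S {w} lw
... | p ∷ ps | _       | _        = p , ps , refl
... | []     | here eq | here eq′ = contradiction (trans eq (sym eq′)) v≢w

some-below : ∀ {k} w → ones w ≡ suc k → ∃ λ v → v ⋖ w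
some-below (true ∷ w)  eq = false ∷ w , here
some-below (false ∷ w) eq with some-below w eq
... | v , c = false ∷ v , there c

below-level : ∀ {m k v w} → v ⋖ w → OnLevel m (suc k) w → OnLevel m k v
below-level c (len , o) = trans (⋖-length c) len , suc-injective (trans (⋖-ones c) o)

above-level : ∀ {m k v w} → v ⋖ w → OnLevel m k v → OnLevel m (suc k) w
above-level c (len , o) = trans (sym (⋖-length c)) len , trans (sym (⋖-ones c)) (cong suc o)

Missing : ∀ {m k} → Saturating m k → Set
Missing {m} {k} S = ∃ λ u → OnLevel m (suc k) u × u ∉ map proj₂ (first S ∷ others S)

-- S₀ goes through z, a, z′ and S₁ through y, z, where y ⋖ z, z′ and S₁ avoids
-- z′.  Replacing the upper vertices 0a and 1z after 0z and 1y by 1z and 1z′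
-- joins the copies of S₀ and S₁ in the two facets, and frees 0a.
join : ∀ {m k} (S₀ : Saturating m (suc k)) (S₁ : Saturating m k) ((z′ , _) : Missing S₁) {a′ : Word} {ps : List Pair} →
       proj₁ (first S₀) ≡ proj₂ (first S₁) → others S₀ ≡ (z′ , a′) ∷ ps →
       proj₁ (first S₁) ⋖ z′ → Σ (Saturating (suc m) (suc k)) Missing
join {m} {k}
  S₀@record { first = z , a ; others = (z′ , a′) ∷ ps ; walk = (z⋖a , _) ∷ walk₀ }
  S₁@record { first = y , _ ; others = qs ; walk = walk₁ }
  (_ , z′-level , z′∉) refl refl y⋖z′ = record
    { first  = false ∷ z , true ∷ z
    ; others = map (both (true ∷_)) qs ++ (true ∷ y , true ∷ z′) ∷ map (both (false ∷_)) ((z′ , a′) ∷ ps)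
    ; walk   = Walk-both there walk₁ here refl refl
            ++ʷ (there y⋖z′ , here) ∷ Walk-both there walk₀ (there (Walk-first walk₀)) refl refl
    ; level  = Product.map (cong suc) id (level S₀)
    ; lowers-unique = Unique-resp-↭ lowers-↭ (Uniqueₚ.++⁺
        (Uniqueₚ.map⁺ ∷-injectiveʳ (lowers-unique S₁)) (Uniqueₚ.map⁺ ∷-injectiveʳ (lowers-unique S₀))
        (facets-disjoint (map proj₁ (first S₁ ∷ qs))))
    ; uppers-unique = Unique-resp-↭ uppers-↭ (Uniqueₚ.++⁺
        (Uniqueₚ.map⁺ ∷-injectiveʳ (¬Any⇒All¬ _ z′∉ ∷ uppers-unique S₁))
        (Uniqueₚ.map⁺ ∷-injectiveʳ (tail (uppers-unique S₀)))
        (facets-disjoint (z′ ∷ map proj₂ (first S₁ ∷ qs))))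
    ; lowers-cover = cover
    } , false ∷ a , Product.map (cong suc) id (above-level z⋖a (level S₀)) , a∉
  where
  others₀ : List Pair
  others₀ = (z′ , a′) ∷ ps

  facets-disjoint : ∀ vs {ws w} → w ∈ map (true ∷_) vs × w ∈ map (false ∷_) ws → ⊥
  facets-disjoint vs (w∈ , w∈′) with ∈-map⁻ (true ∷_) w∈ | ∈-map⁻ (false ∷_) w∈′
  ... | _ , _ , refl | _ , _ , ()

  map-glued : (g : Pair → Word) → (∀ b p → g (both (b ∷_) p) ≡ b ∷ g p) → ∀ {p} →
              map g (map (both (true ∷_)) qs ++ p ∷ map (both (false ∷_)) others₀)
                ≡ map (true ∷_) (map g qs) ++ g p ∷ map (false ∷_) (map g others₀)
  map-glued g eq {p} = trans (map-++ g (map (both (true ∷_)) qs) _)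
    (cong₂ (λ vs ws → vs ++ g p ∷ ws) (map-both g (true ∷_) (eq true) qs) (map-both g (false ∷_) (eq false) others₀))

  lowers-↭ : map (true ∷_) (map proj₁ (first S₁ ∷ qs)) ++ map (false ∷_) (map proj₁ (first S₀ ∷ others₀))
             ↭ (false ∷ z) ∷ map proj₁ (map (both (true ∷_)) qs ++ (true ∷ y , true ∷ z′) ∷ map (both (false ∷_)) others₀)
  lowers-↭ = ↭-trans (shift (false ∷ z) (map (true ∷_) (map proj₁ (first S₁ ∷ qs))) _)
    (prep (false ∷ z) (↭-trans (↭-sym (shift (true ∷ y) (map (true ∷_) (map proj₁ qs)) _))
      (↭-reflexive (sym (map-glued proj₁ (λ _ _ → refl))))))

  uppers-↭ : map (true ∷_) (z′ ∷ map proj₂ (first S₁ ∷ qs)) ++ map (false ∷_) (map proj₂ others₀)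
             ↭ (true ∷ z) ∷ map proj₂ (map (both (true ∷_)) qs ++ (true ∷ y , true ∷ z′) ∷ map (both (false ∷_)) others₀)
  uppers-↭ = ↭-trans (↭-sym (shift (true ∷ z′) (map (true ∷_) (map proj₂ (first S₁ ∷ qs))) _))
    (prep (true ∷ z) (↭-reflexive (sym (map-glued proj₂ (λ _ _ → refl)))))

  cover : ∀ {w} → OnLevel (suc m) (suc k) w →
          w ∈ (false ∷ z) ∷ map proj₁ (map (both (true ∷_)) qs ++ (true ∷ y , true ∷ z′) ∷ map (both (false ∷_)) others₀)
  cover {true ∷ w}  (len , o) = ∈-resp-↭ lowers-↭ (∈-++⁺ˡ
    (∈-map⁺ (true ∷_) (lowers-cover S₁ (suc-injective len , suc-injective o))))
  cover {false ∷ w} (len , o) = ∈-resp-↭ lowers-↭ (∈-++⁺ʳ (map (true ∷_) (map proj₁ (first S₁ ∷ qs)))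
    (∈-map⁺ (false ∷_) (lowers-cover S₀ (suc-injective len , o))))

  a∉ : false ∷ a ∉ (true ∷ z) ∷ map proj₂ (map (both (true ∷_)) qs ++ (true ∷ y , true ∷ z′) ∷ map (both (false ∷_)) others₀)
  a∉ a∈ with ∈-++⁻ (map (true ∷_) (z′ ∷ map proj₂ (first S₁ ∷ qs))) (∈-resp-↭ (↭-sym uppers-↭) a∈)
  ... | inj₁ a∈₁ with ∈-map⁻ (true ∷_) a∈₁
  ...   | _ , _ , ()
  a∉ a∈ | inj₂ a∈₂ with ∈-map⁻ (false ∷_) a∈₂
  ...   | _ , a∈₃ , refl = Unique⇒∉ (uppers-unique S₀) a∈₃

align : ∀ {m k} (S : Saturating m k) {y z z′} → OnLevel m k z → OnLevel m k z′ → z ≢ z′ → y ⋖ z → y ⋖ z′ →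
        Σ (Saturating m k) λ S′ → proj₁ (first S′) ≡ z × ∃₂ λ a ps → others S′ ≡ (z′ , a) ∷ ps
align S@record { first = v , a ; walk = w ; lowers-unique = u } lz lz′ z≢z′ c c′ with second S lz lz′ z≢z′
... | (v′ , a′) , ps , refl with w | u
... | (v⋖a , v′⋖a) ∷ _ | (v≢v′ ∷ _) ∷ _ with neighbours-transitive (level S) lz v⋖a v′⋖a v≢v′ c c′ z≢z′
... | π , refl , refl = transport π S , refl , _ , _ , refl

-- The missing word z′ dictates the rest: y is any word below it, and z is the upper word that the
-- cycle for the smaller levels visits right after y. The other cycle is then permuted so that it
-- passes from z to z′ through one upper word.
extendDimension : ∀ {m k} → Saturating m (suc k) → Σ (Saturating m k) Missing →
                  Σ (Saturating (suc m) (suc k)) Missing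
extendDimension {m} {k} S₀ (S , z′ , z′-level , z′∉) with some-below z′ (proj₂ z′-level)
... | y , y⋖z′ with startingAt S (below-level y⋖z′ z′-level)
... | S₁ , refl , p with align S₀ {y} {proj₂ (first S₁)} {z′} (above-level y⋖z (level S₁)) z′-level z≢z′ y⋖z y⋖z′
  where
  y⋖z : y ⋖ proj₂ (first S₁)
  y⋖z = Walk-first (walk S₁)
  z≢z′ : proj₂ (first S₁) ≢ z′
  z≢z′ refl = z′∉ (∈-resp-↭ (↭-sym (↭-map⁺ proj₂ p)) (here refl))
... | S₀′ , eq , a , ps , eq′ =
  join S₀′ S₁ (z′ , z′-level , z′∉ ∘ ∈-resp-↭ (↭-sym (↭-map⁺ proj₂ p))) eq eq′ y⋖z′

constant : ∀ w → ones w ≡ 0 → w ≡ sorted (length w) 0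
constant []          eq = refl
constant (false ∷ w) eq = cong (false ∷_) (constant w eq)

sorted-level : ∀ m k → k ≤ m → OnLevel m k (sorted m k)
sorted-level zero    zero    k≤m       = refl , refl
sorted-level (suc m) zero    k≤m       = Product.map (cong suc) id (sorted-level m zero z≤n)
sorted-level (suc m) (suc k) (s≤s k≤m) = Product.map (cong suc) (cong suc) (sorted-level m k k≤m)

-- A degenerate cycle of length two; join applies to it nevertheless.
saturating-0 : ∀ m → Σ (Saturating (2 + m) 0) Missing
saturating-0 m = record
  { first  = false ∷ false ∷ sorted m 0 , true ∷ false ∷ sorted m 0
  ; others = []
  ; walk   = last (here , here)
  ; level  = sorted-level (2 + m) 0 z≤n
  ; lowers-unique = [] ∷ []
  ; uppers-unique = [] ∷ []
  ; lowers-cover  = λ {w} (len , o) → here (trans (constant w o) (cong (λ l → sorted l 0) len))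
  } , false ∷ true ∷ sorted m 0
  , Product.map (cong (2 +_)) (cong suc) (sorted-level m 0 z≤n)
  , λ { (here ()) ; (there ()) }

dimension : ∀ d k → 2 + (d + (2 + (k + k))) ≡ d + (2 + (suc k + suc k))
dimension = solve-∀

saturating : ∀ k d → Σ (Saturating (d + (2 + (k + k))) k) Missing
saturating zero    d       = subst (λ m → Σ (Saturating m 0) Missing) (+-comm 2 d) (saturating-0 d)
-- Lowering both the level and the dimension by one raises d by one. Here the facets have dimension
-- 2k+3, the middle dimension for `suc k` and one above the minimum for k.
saturating (suc k) zero    = subst (λ m → Σ (Saturating m (suc k)) Missing) (dimension 0 k)
  (extendDimension (subst (λ m → Saturating m (suc k)) (cong (2 +_) (+-suc k k)) (MiddleLevels.saturating k))
                   (saturating k 1))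
saturating (suc k) (suc d) = subst (λ m → Σ (Saturating m (suc k)) Missing) (dimension (suc d) k)
  (extendDimension (subst (λ m → Saturating m (suc k)) (sym (dimension d k)) (proj₁ (saturating (suc k) d)))
                   (saturating k (2 + d)))

-- Cyclic bracket matching

-- Read 1 and 0 as opening and closing brackets, h being the number of brackets
-- open at the start; the zeros that close nothing are turned into ones.
data Fill : ℕ → Word → Word → ℕ → Set where
  done  : ∀ {h} → Fill h [] [] h
  open₁ : ∀ {h v w e} → Fill (suc h) v w e → Fill h (true ∷ v) (true ∷ w) e
  close : ∀ {h v w e} → Fill h v w e → Fill (suc h) (false ∷ v) (false ∷ w) e
  flip  : ∀ {v w e} → Fill 0 v w e → Fill 0 (false ∷ v) (true ∷ w) e

fill : ℕ → Word → Word
fill h       []          = []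
fill h       (true ∷ w)  = true ∷ fill (suc h) w
fill zero    (false ∷ w) = true ∷ fill zero w
fill (suc h) (false ∷ w) = false ∷ fill h w

unclosed : ℕ → Word → ℕ
unclosed h       []          = h
unclosed h       (true ∷ w)  = unclosed (suc h) w
unclosed zero    (false ∷ w) = unclosed zero w
unclosed (suc h) (false ∷ w) = unclosed h w

fill-Fill : ∀ h w → Fill h w (fill h w) (unclosed h w)
fill-Fill h       []          = done
fill-Fill h       (true ∷ w)  = open₁ (fill-Fill (suc h) w)
fill-Fill zero    (false ∷ w) = flip (fill-Fill zero w)
fill-Fill (suc h) (false ∷ w) = close (fill-Fill h w)

unclosed-mono : ∀ {h h′} w → h ≤ h′ → unclosed h w ≤ unclosed h′ w
unclosed-mono []          le = le
unclosed-mono (true ∷ w)  le = unclosed-mono w (s≤s le)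
unclosed-mono {zero} {zero}   (false ∷ w) le = unclosed-mono w le
unclosed-mono {zero} {suc h′} (false ∷ w) le = unclosed-mono w z≤n
unclosed-mono {suc h} {suc h′} (false ∷ w) (s≤s le) = unclosed-mono w le

-- If the higher scan meets a zero that closes nothing, it is at height 0, where the lower scan must
-- be as well; from then on they agree. Otherwise the higher scan matches every zero, and its height
-- changes by ones minus zeros.
unclosed-merge : ∀ {h h′} w → h ≤ h′ →
                 unclosed h′ w ≡ unclosed h w ⊎ unclosed h′ w + zeros w ≡ h′ + ones w
unclosed-merge []          le = inj₂ refl
unclosed-merge {h} {h′} (true ∷ w)  le with unclosed-merge {suc h} {suc h′} w (s≤s le)
... | inj₁ eq = inj₁ eq
... | inj₂ eq = inj₂ (trans eq (sym (+-suc h′ (ones w))))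
unclosed-merge {zero} {zero}   (false ∷ w) le = inj₁ refl
unclosed-merge {zero} {suc h′} (false ∷ w) le with unclosed-merge {zero} {h′} w z≤n
... | inj₁ eq = inj₁ eq
... | inj₂ eq = inj₂ (trans (+-suc _ (zeros w)) (cong suc eq))
unclosed-merge {suc h} {suc h′} (false ∷ w) (s≤s le) with unclosed-merge {h} {h′} w le
... | inj₁ eq = inj₁ eq
... | inj₂ eq = inj₂ (trans (+-suc _ (zeros w)) (cong suc eq))

-- If a second pass does not merge with the first, it cannot gain height, as there are no more ones
-- than zeros; by monotonicity it cannot end below the first pass either.
unclosed-fixed : ∀ w → ones w ≤ zeros w → unclosed (unclosed 0 w) w ≡ unclosed 0 w
unclosed-fixed w o≤z with unclosed-merge {0} {unclosed 0 w} w z≤n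
... | inj₁ eq = eq
... | inj₂ eq = ≤-antisym
  (+-cancelʳ-≤ (zeros w) _ _ (≤-trans (≤-reflexive eq) (+-monoʳ-≤ (unclosed 0 w) o≤z)))
  (unclosed-mono w z≤n)

-- The brackets left open by a first pass are those available, cyclically, at the start. When there
-- are no more ones than zeros, every one finds a partner; the zeros that survive are these
-- partners, so the complement has as many ones as w and is disjoint from it.
cyclicFill : Word → Word
cyclicFill w = fill (unclosed 0 w) w

cyclicFill-Fill : ∀ w → ones w ≤ zeros w → Fill (unclosed 0 w) w (cyclicFill w) (unclosed 0 w)
cyclicFill-Fill w o≤z =
  subst (Fill (unclosed 0 w) w (cyclicFill w)) (unclosed-fixed w o≤z) (fill-Fill (unclosed 0 w) w)

Fill-height : ∀ {h v w e} → Fill h v w e → h + ones v ≡ e + zeros w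
Fill-height done                      = refl
Fill-height (open₁ {h} {v} f)         = trans (+-suc h (ones v)) (Fill-height f)
Fill-height (close {w = w} {e} f)     = trans (cong suc (Fill-height f)) (sym (+-suc e (zeros w)))
Fill-height (flip f)                  = Fill-height f

Fill-⊑ : ∀ {h v w e} → Fill h v w e → Pointwise Bool._≤_ v w
Fill-⊑ done      = []
Fill-⊑ (open₁ f) = Bool.b≤b ∷ Fill-⊑ f
Fill-⊑ (close f) = Bool.b≤b ∷ Fill-⊑ f
Fill-⊑ (flip f)  = Bool.f≤t ∷ Fill-⊑ f

⊑-ones : ∀ {v w} → Pointwise Bool._≤_ v w → ones v ≤ ones w
⊑-ones []                           = z≤n
⊑-ones (Bool.f≤t ∷ ps)              = m≤n⇒m≤1+n (⊑-ones ps)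
⊑-ones (Bool.b≤b {true} ∷ ps)       = s≤s (⊑-ones ps)
⊑-ones (Bool.b≤b {false} ∷ ps)      = ⊑-ones ps

⊑-antisym : ∀ {v w} → Pointwise Bool._≤_ v w → ones w ≤ ones v → v ≡ w
⊑-antisym []                      le       = refl
⊑-antisym (Bool.f≤t ∷ ps)         le       = contradiction (⊑-ones ps) (<⇒≱ le)
⊑-antisym (Bool.b≤b {true} ∷ ps)  (s≤s le) = cong (true ∷_) (⊑-antisym ps le)
⊑-antisym (Bool.b≤b {false} ∷ ps) le       = cong (false ∷_) (⊑-antisym ps le)

-- Reading backwards, a one of w was flipped exactly if it is reached at height 0.
Fill-compare : ∀ {h h′ v v′ w e e′} → Fill h v w e → Fill h′ v′ w e′ → e ≤ e′ →
               h ≤ h′ × (e ≡ e′ → h ≡ h′ × v ≡ v′) × (h ≡ h′ ⊎ v′ ≡ w)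
Fill-compare done done le = le , (λ eq → eq , refl) , inj₂ refl
Fill-compare (open₁ f) (open₁ g) le with Fill-compare f g le
... | s≤s h≤ , same , inj₁ eq = h≤ , Product.map suc-injective (cong (true ∷_)) ∘ same , inj₁ (suc-injective eq)
... | s≤s h≤ , same , inj₂ eq = h≤ , Product.map suc-injective (cong (true ∷_)) ∘ same , inj₂ (cong (true ∷_) eq)
Fill-compare (open₁ f) (flip g) le with Fill-compare f g le
... | () , _
Fill-compare (flip f) (open₁ g) le with Fill-compare f g le
... | _ , same , inj₂ eq = z≤n , (λ e≡ → contradiction (proj₁ (same e≡)) λ ()) , inj₂ (cong (true ∷_) eq)
Fill-compare (flip f) (flip g) le with Fill-compare f g le
... | _ , same , _ = z≤n , Product.map id (cong (false ∷_)) ∘ same , inj₁ refl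
Fill-compare (close f) (close g) le with Fill-compare f g le
... | h≤ , same , inj₁ eq = s≤s h≤ , Product.map (cong suc) (cong (false ∷_)) ∘ same , inj₁ (cong suc eq)
... | h≤ , same , inj₂ eq = s≤s h≤ , Product.map (cong suc) (cong (false ∷_)) ∘ same , inj₂ (cong (false ∷_) eq)

-- Here the end heights are the start heights. If these agree, reading backwards recovers the word;
-- otherwise nothing of v′ was flipped, so v lies below w = v′ and has equally many ones.
Fill-injective : ∀ {h h′ v v′ w} → Fill h v w h → Fill h′ v′ w h′ → ones v ≡ ones v′ → h ≤ h′ → v ≡ v′
Fill-injective f g o le with Fill-compare f g le
... | _ , same , inj₁ h≡h′ = proj₂ (same h≡h′)
... | _ , _    , inj₂ refl = ⊑-antisym (Fill-⊑ f) (≤-reflexive (sym o))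

cyclicFill-injective : ∀ {v w} → ones v ≤ zeros v → ones w ≤ zeros w → ones v ≡ ones w →
                       cyclicFill v ≡ cyclicFill w → v ≡ w
cyclicFill-injective {v} {w} v≤ w≤ o eq with ≤-total (unclosed 0 v) (unclosed 0 w)
  | subst (λ x → Fill (unclosed 0 v) v x (unclosed 0 v)) eq (cyclicFill-Fill v v≤) | cyclicFill-Fill w w≤
... | inj₁ le | f | g = Fill-injective f g o le
... | inj₂ le | f | g = sym (Fill-injective g f (sym o) le)

-- Padded with false, or truncated, to length n.
toSubset : ∀ n → Word → Subset n
toSubset zero    w       = []
toSubset (suc n) []      = false ∷ toSubset n []
toSubset (suc n) (b ∷ w) = b ∷ toSubset n w

∣toSubset∣ : ∀ n w → length w ≤ n → ∣ toSubset n w ∣ ≡ ones w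
∣toSubset∣ zero    []          le       = refl
∣toSubset∣ (suc n) []          le       = ∣toSubset∣ n [] z≤n
∣toSubset∣ (suc n) (true ∷ w)  (s≤s le) = cong suc (∣toSubset∣ n w le)
∣toSubset∣ (suc n) (false ∷ w) (s≤s le) = ∣toSubset∣ n w le

toSubset-injective : ∀ n {v w} → length v ≡ n → length w ≡ n → toSubset n v ≡ toSubset n w → v ≡ w
toSubset-injective zero    {[]}    {[]}    lv lw eq = refl
toSubset-injective (suc n) {a ∷ v} {b ∷ w} lv lw eq with Vecₚ.∷-injective eq
... | refl , eq′ = cong (a ∷_) (toSubset-injective n (suc-injective lv) (suc-injective lw) eq′)

-- Disjointness and complements of words

Apart : Word → Word → Set
Apart = Pointwise (λ a b → a ∧ b ≡ false)

Apart-adjacent : ∀ n {v w} → Apart v w → Adjacent (toSubset n v) (toSubset n w)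
Apart-adjacent (suc n) []                (suc i , there x∈) = Apart-adjacent n [] (i , x∈)
Apart-adjacent (suc n) (_∷_ {a} {b} eq ps) (zero  , x∈) with a ∧ b
Apart-adjacent (suc n) (_∷_ {a} {b} () ps) (zero  , here) | .true
Apart-adjacent (suc n) (eq ∷ ps)         (suc i , there x∈) = Apart-adjacent n ps (i , x∈)

Apart-sym : ∀ {v w} → Apart v w → Apart w v
Apart-sym = Pointwise.symmetric (λ {a} {b} eq → trans (Boolₚ.∧-comm b a) eq)

⋖-⊑ : ∀ {v w} → v ⋖ w → Pointwise Bool._≤_ v w
⋖-⊑ here      = Bool.f≤t ∷ Pointwise.refl Bool.b≤b
⋖-⊑ (there c) = Bool.b≤b ∷ ⋖-⊑ c

⊑-apart : ∀ {u v w} → Pointwise Bool._≤_ u v → Pointwise Bool._≤_ v w → Apart u (map not w)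
⊑-apart []                       []                       = []
⊑-apart (Bool.f≤t ∷ ps)          (_ ∷ qs)                 = refl ∷ ⊑-apart ps qs
⊑-apart (Bool.b≤b {false} ∷ ps)  (_ ∷ qs)                 = refl ∷ ⊑-apart ps qs
⊑-apart (Bool.b≤b {true} ∷ ps)   (Bool.b≤b ∷ qs)          = refl ∷ ⊑-apart ps qs

ones-not : ∀ w → ones (map not w) ≡ zeros w
ones-not []          = refl
ones-not (true ∷ w)  = ones-not w
ones-not (false ∷ w) = cong suc (ones-not w)

map-not-injective : ∀ {v w} → map not v ≡ map not w → v ≡ w
map-not-injective {[]}    {[]}    eq = refl
map-not-injective {a ∷ v} {b ∷ w} eq with ∷-injective eq
... | eq₁ , eq₂ = cong₂ _∷_ (Boolₚ.not-injective eq₁) (map-not-injective eq₂)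

length-fill : ∀ h w → length (fill h w) ≡ length w
length-fill h       []          = refl
length-fill h       (true ∷ w)  = cong suc (length-fill (suc h) w)
length-fill zero    (false ∷ w) = cong suc (length-fill zero w)
length-fill (suc h) (false ∷ w) = cong suc (length-fill h w)

Unique-map : ∀ {A B : Set} (f : A → B) {xs} → (∀ {x y} → x ∈ xs → y ∈ xs → f x ≡ f y → x ≡ y) →
             Unique xs → Unique (map f xs)
Unique-map f {[]}     inj u = []
Unique-map f {x ∷ xs} inj u@(_ ∷ u′) =
  Allₚ.¬Any⇒All¬ _ fx∉ ∷ Unique-map f (λ x∈ y∈ → inj (there x∈) (there y∈)) u′
  where
  fx∉ : f x ∉ map f xs
  fx∉ fx∈ with ∈-map⁻ f fx∈
  ... | y , y∈ , eq = Unique⇒∉ u (subst (_∈ xs) (sym (inj (here refl) (there y∈) eq)) y∈)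

-- From saturating cycles to cycles in the Kneser graph

interleave : ∀ {A B : Set} → (A → B) → (A → B) → List A → List B
interleave f g = concatMap (λ x → f x ∷ g x ∷ [])

interleave-↭ : ∀ {A B : Set} (f g : A → B) xs → interleave f g xs ↭ map f xs ++ map g xs
interleave-↭ f g []       = refl
interleave-↭ f g (x ∷ xs) = prep (f x) (↭-trans (prep (g x) (interleave-↭ f g xs))
                              (↭-sym (shift (g x) (map f xs) (map g xs))))

absorption : ∀ n k → suc k * (suc n C suc k) ≡ suc n * (n C k)
absorption zero    zero    = refl
absorption zero    (suc k) = *-zeroʳ k
absorption (suc n) zero    = trans (*-identityˡ _) (trans (nC1≡n (2 + n)) (sym (*-identityʳ (2 + n))))
absorption (suc n) (suc k) = begin
  (2 + k) * ((2 + n) C (2 + k))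
    ≡⟨ cong ((2 + k) *_) (sym (nCk+nC[k+1]≡[n+1]C[k+1] (suc n) (suc k))) ⟩
  (2 + k) * (a + suc n C (2 + k))
    ≡⟨ *-distribˡ-+ (2 + k) a _ ⟩
  (a + suc k * a) + (2 + k) * (suc n C (2 + k))
    ≡⟨ cong₂ (λ x y → (a + x) + y) (absorption n k) (absorption n (suc k)) ⟩
  (a + suc n * (n C k)) + suc n * (n C suc k)
    ≡⟨ +-assoc a _ _ ⟩
  a + (suc n * (n C k) + suc n * (n C suc k))
    ≡⟨ cong (a +_) (sym (*-distribˡ-+ (suc n) (n C k) (n C suc k))) ⟩
  a + suc n * (n C k + n C suc k)
    ≡⟨ cong (λ x → a + suc n * x) (nCk+nC[k+1]≡[n+1]C[k+1] n k) ⟩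
  (2 + n) * a ∎
  where
  open ≡-Reasoning
  a = suc n C suc k

Saturating-two : ∀ {m k} (S : Saturating m (suc k)) → 2 + k ≤ m → 2 ≤ length (first S ∷ others S)
Saturating-two {suc (suc m)} {k} S (s≤s (s≤s k≤m)) with sorted-level m k k≤m
... | len , o with second S {true ∷ false ∷ sorted m k} {false ∷ true ∷ sorted m k}
                     (cong (2 +_) len , cong suc o) (cong (2 +_) len , cong suc o) (λ ())
... | _ , ps , eq = subst (λ os → 2 ≤ suc (length os)) (sym eq) (s≤s (s≤s z≤n))

-- The distinguished element is the first coordinate. Adding it to a word of level k+1 gives a
-- (k+2)-set, so the target is K(m+1, k+2), and `two` reads m ≥ 2(k+2).
module KneserFromSaturating {m k : ℕ} (S : Saturating m (suc k)) (two : 2 + (suc k + suc k) ≤ m) where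

  lowVertex upVertex : Pair → Subset (suc m)
  lowVertex (l , _) = toSubset (suc m) (true ∷ l)
  upVertex  (_ , u) = toSubset (suc m) (false ∷ map not (cyclicFill u))

  pairs : List Pair
  pairs = first S ∷ others S

  record Good (p : Pair) : Set where
    constructor good
    field
      lower-level : OnLevel m (suc k) (proj₁ p)
      upper-level : OnLevel m (2 + k) (proj₂ p)
  open Good

  goods : ∀ {p ps q} → Walk Edge p ps q → OnLevel m (suc k) (proj₁ p) → All Good (p ∷ ps)
  goods (last (c , _)) l = good l (above-level c l) ∷ []
  goods {p} (_∷_ {b = q} e@(c , _) w) l = good l (above-level c l) ∷ goods w (Edge-level {p = p} {q} e l)

  all-good : All Good pairs
  all-good = goods (walk S) (level S)

  ones≤zeros : ∀ u → OnLevel m (2 + k) u → ones u ≤ zeros u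
  ones≤zeros u (refl , o) = +-cancelˡ-≤ (ones u) _ _ (≤-trans
    (≤-reflexive (cong₂ _+_ o o)) (≤-trans (≤-reflexive (cong (2 +_) (+-suc k (suc k)))) (≤-trans two (≤-reflexive (sym (ones+zeros u))))))

  -- Every word covered by u lies below `cyclicFill u`, hence is disjoint from its complement. The
  -- set that replaces u is therefore adjacent to both neighbours of u on the cycle.
  Edge-adjacent : ∀ {p q} → Edge p q → OnLevel m (suc k) (proj₁ p) →
                  Adjacent (lowVertex p) (upVertex p) × Adjacent (upVertex p) (lowVertex q)
  Edge-adjacent {l , u} {l′ , _} (c , c′) lv =
      Apart-adjacent (suc m) {true ∷ l} (refl ∷ apart c)
    , Apart-adjacent (suc m) {w = true ∷ l′} (refl ∷ Apart-sym (apart c′))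
    where
    apart : ∀ {v} → v ⋖ u → Apart v (map not (cyclicFill u))
    apart c″ = ⊑-apart (⋖-⊑ c″) (Fill-⊑ (cyclicFill-Fill u (ones≤zeros u (above-level c lv))))

  Walk-linked : ∀ {p ps q} → Walk Edge p ps q → OnLevel m (suc k) (proj₁ p) →
                Linked Adjacent (interleave lowVertex upVertex (p ∷ ps) ++ [ lowVertex q ])
  Walk-linked {p} {q = q} (last e) l with Edge-adjacent {p} {q} e l
  ... | a₁ , a₂ = a₁ ∷ a₂ ∷ [-]
  Walk-linked {p} (_∷_ {b = q} e w) l with Edge-adjacent {p} {q} e l
  ... | a₁ , a₂ = a₁ ∷ a₂ ∷ Walk-linked w (Edge-level {p = p} {q} e l)

  upper-word-level : ∀ u → OnLevel m (2 + k) u → OnLevel m (2 + k) (map not (cyclicFill u))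
  upper-word-level u l@(len , o) = trans (length-map not (cyclicFill u)) (trans (length-fill _ u) len)
    , trans (ones-not (cyclicFill u)) (trans (sym (+-cancelˡ-≡ (unclosed 0 u) _ _
        (Fill-height (cyclicFill-Fill u (ones≤zeros u l))))) o)

  vertices-interleaved : All (IsVertex (suc m) (2 + k)) (interleave lowVertex upVertex pairs)
  vertices-interleaved = All-resp-↭ (↭-sym (interleave-↭ lowVertex upVertex pairs)) (Allₚ.++⁺
    (Allₚ.map⁺ (All.map (λ {p} g → let (len , o) = lower-level g in
      trans (∣toSubset∣ (suc m) (true ∷ proj₁ p) (≤-reflexive (cong suc len))) (cong suc o)) all-good))
    (Allₚ.map⁺ (All.map (λ {p} g → let (len , o) = upper-word-level (proj₂ p) (upper-level g) in
      trans (∣toSubset∣ (suc m) (false ∷ map not (cyclicFill (proj₂ p))) (≤-reflexive (cong suc len))) o) all-good)))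

  lows-unique : Unique (map lowVertex pairs)
  lows-unique = subst Unique (sym (map-∘ pairs)) (Unique-map (toSubset (suc m) ∘ (true ∷_)) inj (lowers-unique S))
    where
    inj : ∀ {v w} → v ∈ map proj₁ pairs → w ∈ map proj₁ pairs →
          toSubset (suc m) (true ∷ v) ≡ toSubset (suc m) (true ∷ w) → v ≡ w
    inj v∈ w∈ eq with ∈-map⁻ proj₁ v∈ | ∈-map⁻ proj₁ w∈
    ... | p , p∈ , refl | q , q∈ , refl = toSubset-injective m
      (proj₁ (lower-level (All.lookup all-good p∈))) (proj₁ (lower-level (All.lookup all-good q∈)))
      (Vecₚ.∷-injectiveʳ eq)

  ups-unique : Unique (map upVertex pairs)
  ups-unique = subst Unique (sym (map-∘ pairs))
    (Unique-map (λ u → toSubset (suc m) (false ∷ map not (cyclicFill u))) inj (uppers-unique S))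
    where
    inj : ∀ {v w} → v ∈ map proj₂ pairs → w ∈ map proj₂ pairs →
          toSubset (suc m) (false ∷ map not (cyclicFill v)) ≡ toSubset (suc m) (false ∷ map not (cyclicFill w)) → v ≡ w
    inj v∈ w∈ eq with ∈-map⁻ proj₂ v∈ | ∈-map⁻ proj₂ w∈
    ... | p , p∈ , refl | q , q∈ , refl =
      cyclicFill-injective (ones≤zeros (proj₂ p) lp) (ones≤zeros (proj₂ q) lq) (trans (proj₂ lp) (sym (proj₂ lq)))
        (map-not-injective (toSubset-injective m (proj₁ (upper-word-level (proj₂ p) lp)) (proj₁ (upper-word-level (proj₂ q) lq))
          (Vecₚ.∷-injectiveʳ eq)))
      where
      lp = upper-level (All.lookup all-good p∈)
      lq = upper-level (All.lookup all-good q∈)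

  interleave-unique : Unique (interleave lowVertex upVertex pairs)
  interleave-unique = Unique-resp-↭ (↭-sym (interleave-↭ lowVertex upVertex pairs))
    (Uniqueₚ.++⁺ lows-unique ups-unique disjoint)
    where
    disjoint : ∀ {x} → x ∈ map lowVertex pairs × x ∈ map upVertex pairs → ⊥
    disjoint (x∈ , x∈′) with ∈-map⁻ lowVertex {xs = pairs} x∈ | ∈-map⁻ upVertex {xs = pairs} x∈′
    ... | p , _ , refl | q , _ , ()

  length-interleave : length (interleave lowVertex upVertex pairs) ≡ length pairs + length pairs
  length-interleave = trans (↭-length (interleave-↭ lowVertex upVertex pairs))
    (trans (length-++ (map lowVertex pairs)) (cong₂ _+_ (length-map lowVertex pairs) (length-map upVertex pairs)))

  enough : m C suc k ≤ length pairs
  enough = subst₂ _≤_ (length-choose m (suc k)) (length-map proj₁ pairs)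
    (Unique-⊆⇒length≤ (choose-unique m (suc k)) (λ {w} w∈ → lowers-cover S (choose-sound m (suc k) w∈)))

  two-pairs : 2 ≤ length pairs
  two-pairs = Saturating-two S (≤-trans (m≤m+n (2 + k) _) (≤-trans (≤-reflexive (shape k)) two))
    where
    shape : ∀ k → 2 + k + (2 + k) ≡ 2 + (suc k + suc k)
    shape = solve-∀

  kneserCycle : KneserCycle (suc m) (2 + k)
  kneserCycle = record
    { start    = lowVertex (first S)
    ; rest     = upVertex (first S) ∷ interleave lowVertex upVertex (others S)
    ; vertices = vertices-interleaved
    ; distinct = interleave-unique
    ; long     = subst (3 ≤_) (sym length-interleave) (≤-trans (n≤1+n 3) (+-mono-≤ two-pairs two-pairs))
    ; edges    = Walk-linked (walk S) (level S)
    }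

  kneserCycle-long : 2 * (2 + k) * numVertices (suc m) (2 + k) ≤ cycleLength kneserCycle * suc m
  kneserCycle-long = begin
    2 * (2 + k) * (suc m C (2 + k))         ≡⟨ *-assoc 2 (2 + k) (suc m C (2 + k)) ⟩
    2 * ((2 + k) * (suc m C (2 + k)))       ≡⟨ cong (2 *_) (absorption m (suc k)) ⟩
    2 * (suc m * (m C suc k))               ≤⟨ *-monoʳ-≤ 2 (*-monoʳ-≤ (suc m) enough) ⟩
    2 * (suc m * length pairs)              ≡⟨ double (suc m) (length pairs) ⟩
    (length pairs + length pairs) * suc m   ≡⟨ cong (_* suc m) (sym length-interleave) ⟩
    cycleLength kneserCycle * suc m         ∎
    where
    open ≤-Reasoning
    double : ∀ a b → 2 * (a * b) ≡ (b + b) * a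
    double = solve-∀

-- For k = 1 the construction would start from a degenerate cycle with two vertices. That number
-- meets the bound, but a cycle needs three.
triangle : ∀ n → KneserCycle (3 + n) 1
triangle n = record
  { start    = toSubset (3 + n) e₁
  ; rest     = toSubset (3 + n) e₂ ∷ toSubset (3 + n) e₃ ∷ []
  ; vertices = ∣toSubset∣ (3 + n) e₁ 3≤ ∷ ∣toSubset∣ (3 + n) e₂ 3≤ ∷ ∣toSubset∣ (3 + n) e₃ 3≤ ∷ []
  ; distinct = ((λ ()) ∷ (λ ()) ∷ []) ∷ ((λ ()) ∷ []) ∷ [] ∷ []
  ; long     = ≤-refl
  ; edges    = Apart-adjacent (3 + n) {e₁} {e₂} (refl ∷ refl ∷ refl ∷ [])
             ∷ Apart-adjacent (3 + n) {e₂} {e₃} (refl ∷ refl ∷ refl ∷ [])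
             ∷ Apart-adjacent (3 + n) {e₃} {e₁} (refl ∷ refl ∷ refl ∷ []) ∷ [-]
  }
  where
  e₁ e₂ e₃ : Word
  e₁ = true ∷ false ∷ false ∷ []
  e₂ = false ∷ true ∷ false ∷ []
  e₃ = false ∷ false ∷ true ∷ []
  3≤ : 3 ≤ 3 + n
  3≤ = m≤m+n 3 n

longCycle : (k n : ℕ) → 1 ≤ k → 2 * k + 1 ≤ n →
            ∃ λ (c : KneserCycle n k) → 2 * k * numVertices n k ≤ cycleLength c * n
longCycle (suc zero) (suc (suc (suc n))) _ _ = triangle n
  , ≤-trans (≤-reflexive (cong (2 *_) (nC1≡n (3 + n)))) (*-monoˡ-≤ (3 + n) (n≤1+n 2))
longCycle (suc zero) (suc (suc zero)) _ (s≤s (s≤s ()))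
longCycle (suc zero) (suc zero)       _ (s≤s ())
longCycle (suc (suc k)) (suc m) _ 2k<n = kneserCycle , kneserCycle-long
  where
  dim : 2 + (suc k + suc k) ≤ m
  dim = ≤-pred (subst (_≤ suc m) (eq k) 2k<n)
    where
    eq : ∀ k → 2 * (2 + k) + 1 ≡ suc (2 + (suc k + suc k))
    eq = solve-∀
  open KneserFromSaturating (subst (λ l → Saturating l (suc k)) (m∸n+n≡m dim)
    (proj₁ (saturating (suc k) (m ∸ (2 + (suc k + suc k)))))) dim

theorem11 : ((k n : ℕ) → 1 ≤ k → 2 * k + 1 ≤ n →
    ∃ λ (c : KneserCycle n k) → 2 * k * numVertices n k ≤ cycleLength c * n)
    × ((k : ℕ) → 1 ≤ k →
    ∃ λ (c : KneserCycle (2 * k + 1) k) →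
    (2 * k + 1) * numVertices (2 * k + 1) k ∸ numVertices (2 * k + 1) k ≤ cycleLength c * (2 * k + 1))
theorem11 = longCycle , λ k 1≤k → let c , c-long = longCycle k (2 * k + 1) 1≤k ≤-refl in
  c , ≤-trans (≤-reflexive (minus-one (2 * k) (numVertices (2 * k + 1) k))) c-long
  where
  -- With denominators cleared, 1 - 1/(2k+1) and 2k/(2k+1) give the same bound.
  minus-one : ∀ a v → (a + 1) * v ∸ v ≡ a * v
  minus-one a v = trans (cong (λ b → b * v ∸ v) (+-comm a 1)) (m+n∸m≡n v (a * v))
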